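{- Let $\Gamma=\mathbf{c}^{ -1}(\mathrm{SO}_3(\mathbb{Z}[i]))\subset\mathrm{SL}_2(\mathbb{C})$ and $\Gamma_{\mathbb R}=\Gamma\cap\mathrm{SL}_2(\mathbb{R})$. Let $\mathcal{G}\subset\mathbb{C}$ be the closed triangle with vertices $1,2,1+i$, let $\mathcal{G}_{\mathbb R}=[0,2]$, and let $$\mathcal F(\mathcal G)=\{z\in\mathbb{H}^3: x(z)\in\mathcal G,\ y(z)\ge y(\gamma z)\ \forall\gamma\in\Gamma\},\qquad \mathcal F_{\mathbb R}(\mathcal G_{\mathbb R})=\{z\in\mathbb{H}^2: x(z)\in\mathcal G_{\mathbb R},\ y(z)\ge y(\gamma z)\ \forall\gamma\in\Gamma_{\mathbb R}\}.$$ Let $T_1=\begin{pmatrix}1&1\\0&1\end{pmatrix}$ and $R_{\pi/2}=\begin{pmatrix}\omega_8&0\\0&\omega_8^{ -1}\end{pmatrix}$ with $\omega_8=e^{\pi i/4}$. Then, identifying $\mathbb{H}^2$ with $\mathbb{H}^2_{\mathbf j}\subset\mathbb{H}^3$, $$\mathcal F_{\mathbb R}(\mathcal G_{\mathbb R})=\Bigl(\mathcal F(\mathcal G)\cup \bigl(T_1R_{\pi/2}^2T_1^{ -1}\bigr)\mathcal F(\mathcal G)\Bigr)\cap\mathbb{H}^2_{\mathbf j}.$$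
   Context: $\mathbb{H}^3=\{x_1+x_2 i+y\mathbf{j}: x_1,x_2\in\mathbb{R},\ y>0\}$ inside the quaternions; $x(z)=x_1+x_2i\in\mathbb{C}$, $y(z)=y$; $\mathrm{SL}_2(\mathbb{C})$ acts by $z\mapsto(az+b)(cz+d)^{ -1}$. $\mathbb{H}^2_{\mathbf j}=\{x_1+y\mathbf j\}$ is the vertical half-plane $x_2=0$, identified with the upper half-plane $\mathbb{H}^2$ by $x_1+y\mathbf j\leftrightarrow x_1+iy$. For $g\in \mathrm{SL}_2(\mathbb{C})$, $\mathbf{c}(g)$ is the matrix of $X\mapsto gXg^{ -1}$ on $\mathfrak{sl}_2(\mathbb{C})$ with respect to the basis $X_1=\begin{pmatrix}0&1\\1&0\end{pmatrix}$, $X_2=\begin{pmatrix}0&i\\-i&0\end{pmatrix}$, $Y=\begin{pmatrix}1&0\\0&-1\end{pmatrix}$, orthonormal for $\frac12\mathrm{Tr}(XY)$; $\mathbf c:\mathrm{SL}_2(\mathbb{C})\to\mathrm{SO}_3(\mathbb{C})$ is surjective with kernel $\{\pm I\}$. $\mathrm{SO}_3(\mathbb{Z}[i])$ consists of the matrices of $\mathrm{SO}_3(\mathbb{C})$ with entries in $\mathbb{Z}[i]$. -}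

module Defs where

open import Level using (_⊔_) renaming (suc to lsuc)
open import Algebra using (CommutativeRing; Op₁; Invertible)
import Algebra.Properties.Semiring.Mult as SemiringMult
import Algebra.Properties.Ring as RingProperties
import Algebra.Solver.Ring.NaturalCoefficients.Default as NatSolver
open import Data.Fin using (Fin; zero; suc)
open import Data.Integer using (ℤ; +_; -[1+_])
open import Data.Nat using (ℕ)
open import Data.Product using (∃; ∃-syntax; _×_; _,_; proj₁; proj₂)
open import Data.Sum using (inj₁; inj₂)
open import Relation.Binary using (Rel; IsDecTotalOrder)
import Relation.Binary.Construct.NonStrictToStrict as ToStrict
open import Relation.Nullary using (¬_; yes; no; contradiction)
open import Relation.Unary using (Pred; _∈_; _∩_; _∪_)

-- The real numbers, given by their classical axioms (unique up to isomorphism):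
-- a Dedekind-complete totally ordered field.  Decidability of the order is the
-- classical law of trichotomy.
record Reals c ℓ : Set (lsuc (c ⊔ ℓ)) where
  infix 4 _≤_
  field
    commutativeRing : CommutativeRing c ℓ
  open CommutativeRing commutativeRing public hiding (_≉_) renaming (refl to ≈-refl; sym to ≈-sym; trans to ≈-trans)
  field
    _≤_             : Rel Carrier ℓ
    isDecTotalOrder : IsDecTotalOrder _≈_ _≤_
    0≉1             : ¬ 0# ≈ 1#
    invertible      : ∀ x → ¬ x ≈ 0# → Invertible _≈_ 1# _*_ x
    +-monoˡ-≤       : ∀ z {x y} → x ≤ y → x + z ≤ y + z
    *-nonNeg        : ∀ {x y} → 0# ≤ x → 0# ≤ y → 0# ≤ x * y

  IsUpperBound : Pred Carrier ℓ → Pred Carrier (c ⊔ ℓ)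
  IsUpperBound P b = ∀ x → P x → x ≤ b

  field
    supremum : (P : Pred Carrier ℓ) → ∃ P → ∃ (IsUpperBound P) →
               ∃[ s ] (IsUpperBound P s × (∀ b → IsUpperBound P b → s ≤ b))

  open IsDecTotalOrder isDecTotalOrder public using (_≟_; _≤?_; total; antisym)
    renaming (refl to ≤-refl; trans to ≤-trans; reflexive to ≤-reflexive)
  open ToStrict _≈_ _≤_ public using (_<_)

module RealFacts {c ℓ} (ℛ : Reals c ℓ) where
  open Reals ℛ
  open RingProperties ring using (-‿involutive; -1*x≈-x)
  open NatSolver commutativeSemiring using (solve; _:=_; _:+_; _:*_; con)

  2# : Carrier
  2# = 1# + 1#

  private
    ≤-resp : ∀ {x x′ y y′} → x ≈ x′ → y ≈ y′ → x ≤ y → x′ ≤ y′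
    ≤-resp p q r = ≤-trans (≤-reflexive (≈-sym p)) (≤-trans r (≤-reflexive q))

    +-cancel : ∀ x y → (x - y) + y ≈ x
    +-cancel x y = ≈-trans (+-assoc x (- y) y)
      (≈-trans (+-congˡ (-‿inverseˡ y)) (+-identityʳ x))

    ≤⇒0≤- : ∀ {x y} → x ≤ y → 0# ≤ y - x
    ≤⇒0≤- {x} p = ≤-resp (-‿inverseʳ x) ≈-refl (+-monoˡ-≤ (- x) p)

    0≤-⇒≤ : ∀ {x y} → 0# ≤ y - x → x ≤ y
    0≤-⇒≤ {x} {y} p = ≤-resp (+-identityˡ x) (+-cancel y x) (+-monoˡ-≤ x p)

    +-mono : ∀ {w x y z} → w ≤ x → y ≤ z → w + y ≤ x + z
    +-mono {w} {x} {y} {z} p q = ≤-trans (+-monoˡ-≤ y p)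
      (≤-resp (+-comm y x) (+-comm z x) (+-monoˡ-≤ x q))

    *-mono : ∀ {x y u} → 0# ≤ u → x ≤ y → x * u ≤ y * u
    *-mono {x} {y} {u} 0≤u p =
      ≤-resp (+-identityˡ (x * u))
        (≈-trans (≈-sym (distribʳ u (y - x) x)) (*-congʳ (+-cancel y x)))
        (+-monoˡ-≤ (x * u) (*-nonNeg (≤⇒0≤- p) 0≤u))

    0≤1 : 0# ≤ 1#
    0≤1 with total 0# 1#
    ... | inj₁ p = p
    ... | inj₂ p = ≤-resp ≈-refl
      (≈-trans (-1*x≈-x (- 1#)) (-‿involutive 1#)) (*-nonNeg q q)
      where q : 0# ≤ - 1#
            q = ≤-resp ≈-refl (+-identityˡ (- 1#)) (≤⇒0≤- p)

    1≤2 : 1# ≤ 2#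
    1≤2 = ≤-resp (+-identityˡ 1#) ≈-refl (+-monoˡ-≤ 1# 0≤1)

    0≤2 : 0# ≤ 2#
    0≤2 = ≤-trans 0≤1 1≤2

    IsSmall : Pred Carrier ℓ
    IsSmall x = x * x ≤ 2#

    1-small : IsSmall 1#
    1-small = ≤-resp (≈-sym (*-identityˡ 1#)) ≈-refl 1≤2

    2-bounds : IsUpperBound IsSmall 2#
    2-bounds x p with total x 2#
    ... | inj₁ q = q
    ... | inj₂ q = ≤-trans
      (≤-resp (*-identityˡ x) ≈-refl
        (*-mono (≤-trans 0≤2 q) (≤-trans 1≤2 q))) p

    sup : ∃[ s ] (IsUpperBound IsSmall s × (∀ b → IsUpperBound IsSmall b → s ≤ b))
    sup = supremum IsSmall (1# , 1-small) (2# , 2-bounds)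

  √2 : Carrier
  √2 = proj₁ sup

  1≤√2 : 1# ≤ √2
  1≤√2 = proj₁ (proj₂ sup) 1# 1-small

  -- The Möbius image t = (2s+2)/(s+2) of s = √2 satisfies
  -- t - s = (2-s²)/(s+2) and 2 - t² = 2(2-s²)/(s+2)².
  √2*√2≈2 : √2 * √2 ≈ 2#
  √2*√2≈2 = ss≈2
    where
    s = √2
    s₂ = s + 2#
    0≤s : 0# ≤ s
    0≤s = ≤-trans 0≤1 1≤√2
    1≤s₂ : 1# ≤ s₂
    1≤s₂ = ≤-resp (+-identityˡ 1#) ≈-refl (+-mono 0≤s 1≤2)
    s₂≉0 : ¬ s₂ ≈ 0#
    s₂≉0 e = 0≉1 (antisym 0≤1 (≤-trans 1≤s₂ (≤-reflexive e)))
    u = proj₁ (invertible s₂ s₂≉0)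
    s₂u : s₂ * u ≈ 1#
    s₂u = proj₂ (proj₂ (invertible s₂ s₂≉0))
    us₂ : u * s₂ ≈ 1#
    us₂ = ≈-trans (*-comm u s₂) s₂u
    0≤u : 0# ≤ u
    0≤u with total 0# u
    ... | inj₁ p = p
    ... | inj₂ p = contradiction
      (antisym 0≤1 (≤-resp us₂ (zeroˡ s₂) (*-mono (≤-trans 0≤1 1≤s₂) p))) 0≉1
    t = (2# * s + 2#) * u
    0≤uu : 0# ≤ u * u
    0≤uu = *-nonNeg 0≤u 0≤u
    k = 2# * s + 2#
    s-eq : (s * s + 2# * s) * u ≈ s
    s-eq = ≈-trans (*-congʳ (solve 1 (λ s → s :* s :+ con 2 :* s := s :* (s :+ con 2)) ≈-refl s))
      (≈-trans (*-assoc s s₂ u) (≈-trans (*-congˡ s₂u) (*-identityʳ s)))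
    t-eq : (2# + 2# * s) * u ≈ t
    t-eq = *-congʳ (+-comm 2# (2# * s))
    s₂² : (s₂ * s₂) * (u * u) ≈ 1#
    s₂² = ≈-trans (solve 2 (λ a u → (a :* a) :* (u :* u) := (a :* u) :* (a :* u)) ≈-refl s₂ u)
      (≈-trans (*-cong s₂u s₂u) (*-identityˡ 1#))
    common : Carrier
    common = 2# * (s * s) + (2# * 2#) * (2# * s) + 2# * 2#
    tt-eq : (2# * (s * s) + common) * (u * u) ≈ t * t
    tt-eq = solve 2 (λ s u →
        (con 2 :* (s :* s) :+ (con 2 :* (s :* s) :+ (con 2 :* con 2) :* (con 2 :* s) :+ con 2 :* con 2)) :* (u :* u)
        := ((con 2 :* s :+ con 2) :* u) :* ((con 2 :* s :+ con 2) :* u)) ≈-refl s u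
    2-eq : (2# * 2# + common) * (u * u) ≈ 2#
    2-eq = ≈-trans (solve 2 (λ s u →
        (con 2 :* con 2 :+ (con 2 :* (s :* s) :+ (con 2 :* con 2) :* (con 2 :* s) :+ con 2 :* con 2)) :* (u :* u)
        := con 2 :* (((s :+ con 2) :* (s :+ con 2)) :* (u :* u))) ≈-refl s u)
      (≈-trans (*-congˡ s₂²) (*-identityʳ 2#))
    double : ∀ {a b} → a ≤ b → 2# * a ≤ 2# * b
    double {a} {b} p = ≤-resp (*-comm a 2#) (*-comm b 2#) (*-mono 0≤2 p)
    t≈s⇒ : t ≈ s → s * s ≈ 2#
    t≈s⇒ e = ≈-trans (≈-sym (+-identityʳ (s * s)))
      (≈-trans (+-congˡ (≈-sym (-‿inverseʳ (2# * s))))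
      (≈-trans (≈-sym (+-assoc (s * s) (2# * s) (- (2# * s))))
      (≈-trans (+-congʳ main)
      (≈-trans (+-assoc 2# (2# * s) (- (2# * s)))
      (≈-trans (+-congˡ (-‿inverseʳ (2# * s))) (+-identityʳ 2#))))))
      where
      undo : ∀ a → (a * u) * s₂ ≈ a
      undo a = ≈-trans (*-assoc a u s₂) (≈-trans (*-congˡ us₂) (*-identityʳ a))
      main : s * s + 2# * s ≈ 2# + 2# * s
      main = ≈-trans (≈-sym (undo _))
        (≈-trans (*-congʳ (≈-trans s-eq (≈-trans (≈-sym e) (≈-sym t-eq)))) (undo _))
    ss≈2 : s * s ≈ 2#
    ss≈2 with total (s * s) 2#
    ... | inj₁ p = t≈s⇒ (antisym (proj₁ (proj₂ sup) t tt≤2)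
        (≤-resp s-eq t-eq (*-mono 0≤u (+-monoˡ-≤ (2# * s) p))))
      where
      tt≤2 : t * t ≤ 2#
      tt≤2 = ≤-resp tt-eq 2-eq (*-mono 0≤uu (+-monoˡ-≤ common (double p)))
    ... | inj₂ p = t≈s⇒ (antisym
        (≤-resp t-eq s-eq (*-mono 0≤u (+-monoˡ-≤ (2# * s) p)))
        (proj₂ (proj₂ sup) t bound))
      where
      2≤tt : 2# ≤ t * t
      2≤tt = ≤-resp 2-eq tt-eq (*-mono 0≤uu (+-monoˡ-≤ common (double p)))
      0≤k : 0# ≤ k
      0≤k = ≤-resp (+-identityˡ 0#) ≈-refl (+-mono (*-nonNeg 0≤2 0≤s) 0≤2)
      0≤t : 0# ≤ t
      0≤t = *-nonNeg 0≤k 0≤u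
      t≉0 : ¬ t ≈ 0#
      t≉0 e = 0≉1 (antisym 0≤1 (≤-trans 1≤2
        (≤-trans 2≤tt (≤-reflexive (≈-trans (*-congʳ e) (zeroˡ t))))))
      bound : IsUpperBound IsSmall t
      bound x q with total x t
      ... | inj₁ r = r
      ... | inj₂ r = ≤-reflexive (≈-trans (≈-sym (cancel x))
                       (≈-trans (*-congʳ xt≈tt) (cancel t)))
        where
        v = proj₁ (invertible t t≉0)
        cancel : ∀ a → (a * t) * v ≈ a
        cancel a = ≈-trans (*-assoc a t v)
          (≈-trans (*-congˡ (proj₂ (proj₂ (invertible t t≉0)))) (*-identityʳ a))
        xt≈tt : x * t ≈ t * t
        xt≈tt = antisym
          (≤-trans (≤-resp (*-comm t x) ≈-refl (*-mono (≤-trans 0≤t r) r))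
                   (≤-trans q 2≤tt))
          (*-mono 0≤t r)

module Geometry {c ℓ} (ℛ : Reals c ℓ) where
  open Reals ℛ
  open RealFacts ℛ using (2#; √2)
  open SemiringMult semiring using () renaming (_×_ to _×ℝ_)

  -- Total inverse with 0⁻¹ = 0; below, only nonzero elements get inverted.
  infix 8 _⁻¹
  _⁻¹ : Op₁ Carrier
  x ⁻¹ with x ≟ 0#
  ... | yes _   = 0#
  ... | no  x≉0 = proj₁ (invertible x x≉0)

  fromℤ : ℤ → Carrier
  fromℤ (+ n)    = n ×ℝ 1#
  fromℤ -[1+ n ] = - (ℕ.suc n ×ℝ 1#)

  infix 5 _+i_
  record ℂ : Set c where
    constructor _+i_
    field
      re im : Carrier
  open ℂ public

  infix 4 _≈ℂ_
  infixl 6 _+ℂ_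
  infixl 7 _*ℂ_
  infix 8 -ℂ_

  _≈ℂ_ : Rel ℂ ℓ
  z ≈ℂ w = re z ≈ re w × im z ≈ im w

  fromℝ : Carrier → ℂ
  fromℝ x = x +i 0#

  0ℂ 1ℂ iℂ : ℂ
  0ℂ = fromℝ 0#
  1ℂ = fromℝ 1#
  iℂ = 0# +i 1#

  _+ℂ_ _*ℂ_ : ℂ → ℂ → ℂ
  z +ℂ w = (re z + re w) +i (im z + im w)
  z *ℂ w = (re z * re w - im z * im w) +i (re z * im w + im z * re w)

  -ℂ_ _⁻¹ℂ : ℂ → ℂ
  -ℂ z = (- re z) +i (- im z)
  z ⁻¹ℂ = (re z * n ⁻¹) +i (- im z * n ⁻¹)
    where n = re z * re z + im z * im z

  IsReal : Pred ℂ ℓ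
  IsReal z = im z ≈ 0#

  IsGaussianInteger : Pred ℂ ℓ
  IsGaussianInteger z = ∃[ m ] ∃[ n ] z ≈ℂ (fromℤ m +i fromℤ n)

  -- The quaternion q₀ + q₁ i + q₂ j + q₃ k.
  record ℍ : Set c where
    constructor quat
    field
      q₀ q₁ q₂ q₃ : Carrier
  open ℍ public

  infix 4 _≈ℍ_
  infixl 6 _+ℍ_
  infixl 7 _*ℍ_

  _≈ℍ_ : Rel ℍ ℓ
  p ≈ℍ q = q₀ p ≈ q₀ q × q₁ p ≈ q₁ q × q₂ p ≈ q₂ q × q₃ p ≈ q₃ q

  fromℂ : ℂ → ℍ
  fromℂ z = quat (re z) (im z) 0# 0#

  _+ℍ_ _*ℍ_ : ℍ → ℍ → ℍ
  quat a b c d +ℍ quat a′ b′ c′ d′ = quat (a + a′) (b + b′) (c + c′) (d + d′)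
  quat a b c d *ℍ quat a′ b′ c′ d′ = quat
    (a * a′ - b * b′ - c * c′ - d * d′)
    (a * b′ + b * a′ + c * d′ - d * c′)
    (a * c′ - b * d′ + c * a′ + d * b′)
    (a * d′ + b * c′ - c * b′ + d * a′)

  _⁻¹ℍ : ℍ → ℍ
  quat a b c d ⁻¹ℍ = quat (a * n ⁻¹) (- b * n ⁻¹) (- c * n ⁻¹) (- d * n ⁻¹)
    where n = a * a + b * b + c * c + d * d

  -- mat a b c d has rows (a b) and (c d).
  record M₂ : Set c where
    constructor mat
    field
      m₁₁ m₁₂ m₂₁ m₂₂ : ℂ
  open M₂ public

  infix 4 _≈M_
  infixl 6 _+M_
  infixl 7 _*M_ _•M_

  _≈M_ : Rel M₂ ℓ
  A ≈M B = m₁₁ A ≈ℂ m₁₁ B × m₁₂ A ≈ℂ m₁₂ B × m₂₁ A ≈ℂ m₂₁ B × m₂₂ A ≈ℂ m₂₂ B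

  _+M_ _*M_ : M₂ → M₂ → M₂
  mat a b c d +M mat a′ b′ c′ d′ =
    mat (a +ℂ a′) (b +ℂ b′) (c +ℂ c′) (d +ℂ d′)
  mat a b c d *M mat a′ b′ c′ d′ =
    mat (a *ℂ a′ +ℂ b *ℂ c′) (a *ℂ b′ +ℂ b *ℂ d′)
        (c *ℂ a′ +ℂ d *ℂ c′) (c *ℂ b′ +ℂ d *ℂ d′)

  _•M_ : ℂ → M₂ → M₂
  z •M mat a b c d = mat (z *ℂ a) (z *ℂ b) (z *ℂ c) (z *ℂ d)

  det : M₂ → ℂ
  det (mat a b c d) = a *ℂ d +ℂ -ℂ (b *ℂ c)

  -- The inverse of a matrix of determinant 1.
  _⁻¹M : M₂ → M₂
  mat a b c d ⁻¹M = mat d (-ℂ b) (-ℂ c) a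

  SL₂ℂ SL₂ℝ : Pred M₂ ℓ
  SL₂ℂ g = det g ≈ℂ 1ℂ
  SL₂ℝ = SL₂ℂ ∩ λ g → IsReal (m₁₁ g) × IsReal (m₁₂ g) × IsReal (m₂₁ g) × IsReal (m₂₂ g)

  M₃ : Set c
  M₃ = Fin 3 → Fin 3 → ℂ

  private
    pattern 𝟎 = zero
    pattern 𝟏 = suc zero
    pattern 𝟐 = suc (suc zero)

  det₃ : M₃ → ℂ
  det₃ A = A 𝟎 𝟎 *ℂ (A 𝟏 𝟏 *ℂ A 𝟐 𝟐 +ℂ -ℂ (A 𝟏 𝟐 *ℂ A 𝟐 𝟏))
        +ℂ -ℂ (A 𝟎 𝟏 *ℂ (A 𝟏 𝟎 *ℂ A 𝟐 𝟐 +ℂ -ℂ (A 𝟏 𝟐 *ℂ A 𝟐 𝟎)))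
        +ℂ A 𝟎 𝟐 *ℂ (A 𝟏 𝟎 *ℂ A 𝟐 𝟏 +ℂ -ℂ (A 𝟏 𝟏 *ℂ A 𝟐 𝟎))

  I₃ : M₃
  I₃ 𝟎 𝟎 = 1ℂ
  I₃ 𝟏 𝟏 = 1ℂ
  I₃ 𝟐 𝟐 = 1ℂ
  I₃ _ _ = 0ℂ

  SO₃ℂ SO₃ℤ[i] : Pred M₃ ℓ
  SO₃ℂ A =
    (∀ j k → A 𝟎 j *ℂ A 𝟎 k +ℂ A 𝟏 j *ℂ A 𝟏 k +ℂ A 𝟐 j *ℂ A 𝟐 k ≈ℂ I₃ j k)
    × det₃ A ≈ℂ 1ℂ
  SO₃ℤ[i] = SO₃ℂ ∩ λ A → ∀ j k → IsGaussianInteger (A j k)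

  -- The basis X₁, X₂, Y of 𝔰𝔩₂(ℂ).
  basis : Fin 3 → M₂
  basis 𝟎 = mat 0ℂ 1ℂ 1ℂ 0ℂ
  basis 𝟏 = mat 0ℂ iℂ (-ℂ iℂ) 0ℂ
  basis 𝟐 = mat 1ℂ 0ℂ 0ℂ (-ℂ 1ℂ)

  -- A = 𝐜(g): column j of A holds the coordinates of g Bⱼ g⁻¹ in the basis B.
  _Is𝐜_ : M₃ → M₂ → Set ℓ
  A Is𝐜 g = ∀ j → g *M basis j *M g ⁻¹M ≈M
    A 𝟎 j •M basis 𝟎 +M A 𝟏 j •M basis 𝟏 +M A 𝟐 j •M basis 𝟐

  Γ Γℝ : Pred M₂ (c ⊔ ℓ)
  Γ  = SL₂ℂ ∩ λ g → ∃[ A ] (A Is𝐜 g × A ∈ SO₃ℤ[i])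
  Γℝ = Γ ∩ SL₂ℝ

  xℍ : ℍ → ℂ
  xℍ q = q₀ q +i q₁ q

  yℍ : ℍ → Carrier
  yℍ = q₂

  ℍ³ ℍ²ⱼ : Pred ℍ ℓ
  ℍ³ q = q₃ q ≈ 0# × 0# < yℍ q
  ℍ²ⱼ q = q ∈ ℍ³ × im (xℍ q) ≈ 0#

  ℍ² : Pred ℂ ℓ
  ℍ² z = 0# < im z

  infixr 7 _·_ _·₂_
  _·_ : M₂ → ℍ → ℍ
  mat a b c d · z =
    (fromℂ a *ℍ z +ℍ fromℂ b) *ℍ (fromℂ c *ℍ z +ℍ fromℂ d) ⁻¹ℍ

  _·₂_ : M₂ → ℂ → ℂ
  mat a b c d ·₂ z = (a *ℂ z +ℂ b) *ℂ (c *ℂ z +ℂ d) ⁻¹ℂ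

  infix 8 _⟦_⟧
  _⟦_⟧ : ∀ {p} → M₂ → Pred ℍ p → Pred ℍ (c ⊔ ℓ ⊔ p)
  (g ⟦ S ⟧) w = ∃[ z ] (z ∈ S × w ≈ℍ g · z)

  toℍ²ⱼ : ℂ → ℍ
  toℍ²ⱼ z = quat (re z) 0# (im z) 0#

  toℍ²ⱼ⟦_⟧ : ∀ {p} → Pred ℂ p → Pred ℍ (c ⊔ ℓ ⊔ p)
  toℍ²ⱼ⟦ S ⟧ w = ∃[ z ] (z ∈ S × w ≈ℍ toℍ²ⱼ z)

  -- The closed triangle (convex hull) with the given vertices.
  Triangle : ℂ → ℂ → ℂ → Pred ℂ (c ⊔ ℓ)
  Triangle u v w z = ∃[ r ] ∃[ s ] ∃[ t ]
    (0# ≤ r × 0# ≤ s × 0# ≤ t × r + s + t ≈ 1# ×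
     z ≈ℂ fromℝ r *ℂ u +ℂ fromℝ s *ℂ v +ℂ fromℝ t *ℂ w)

  𝒢 : Pred ℂ (c ⊔ ℓ)
  𝒢 = Triangle 1ℂ (fromℝ 2#) (1ℂ +ℂ iℂ)

  𝒢ℝ : Pred Carrier ℓ
  𝒢ℝ x = 0# ≤ x × x ≤ 2#

  ℱ : ∀ {p} → Pred ℂ p → Pred ℍ (c ⊔ ℓ ⊔ p)
  ℱ G z = z ∈ ℍ³ × xℍ z ∈ G × (∀ γ → γ ∈ Γ → yℍ (γ · z) ≤ yℍ z)

  ℱℝ : ∀ {p} → Pred Carrier p → Pred ℂ (c ⊔ ℓ ⊔ p)
  ℱℝ G z = z ∈ ℍ² × re z ∈ G × (∀ γ → γ ∈ Γℝ → im (γ ·₂ z) ≤ im z)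

  -- e^{πi/4} = (1 + i)/√2.
  ω₈ : ℂ
  ω₈ = (√2 ⁻¹) +i (√2 ⁻¹)

  T₁ Rπ/2 : M₂
  T₁   = mat 1ℂ 1ℂ 0ℂ 1ℂ
  Rπ/2 = mat ω₈ 0ℂ 0ℂ (ω₈ ⁻¹ℂ)

-- Since y(γz) = y / (|cx + d|² + |c|²y²) for γ with bottom row (c , d), both
-- sides are the set of x + yj with 0 ≤ x ≤ 2, y > 0 and (x - 1)² + y² ≥ 2.
-- The last condition is forced by one element of Γℝ, the rotation by π/2
-- about i; the converse is that it makes |cx + d|² + |c|²y² ≥ 1 for every
-- γ ∈ Γ.  This reduces to x = 0 and x = 2, that is, to |c|² + |d|² ≥ 1 and
-- |c|² + |2c + d|² ≥ 1, which hold because c² + d², 2cd and 2c² are Gaussian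
-- integers.  Finally T₁ R²_{π/2} T₁⁻¹ acts on x by x ↦ 2 - x, and the triangle
-- meets the real line in [1 , 2].

module Submission where

open import Defs
open import Relation.Unary using (_∈_; _≐_; _∪_; _∩_)
open import Algebra.Bundles using (RawRing)
import Algebra.Properties.Ring as RingProperties
import Algebra.Properties.Semiring.Mult as Mult
import Algebra.Properties.Semiring.Mult.TCOptimised as Mult′
import Algebra.Solver.Ring as RingSolver
open import Algebra.Solver.Ring.AlmostCommutativeRing
  using (fromCommutativeRing; _-Raw-AlmostCommutative⟶_)
open import Data.Fin using (Fin; zero; suc)
open import Data.Integer.Base as ℤ using (ℤ; +_; -[1+_])
import Data.Integer.Properties as ℤ
open import Data.Maybe.Base using (Maybe; map)
open import Data.Nat.Base as ℕ using (ℕ)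
open import Data.Product using (_×_; _,_; proj₁; proj₂)
open import Data.Sum using (_⊎_; inj₁; inj₂)
open import Data.Vec.Base using (Vec; []; _∷_)
open import Relation.Binary.Consequences using (dec⇒weaklyDec)
open import Relation.Binary.PropositionalEquality as ≡ using ()
import Relation.Binary.Reasoning.Setoid as SetoidReasoning
open import Relation.Nullary using (¬_; yes; no; contradiction)

pattern 𝟎 = zero
pattern 𝟏 = suc zero
pattern 𝟐 = suc (suc zero)
pattern 𝟑 = suc (suc (suc zero))

-- The ring solver for the reals with integer coefficients.

module IntegerSolver {c ℓ} (ℛ : Reals c ℓ) where
  open Reals ℛ
  open Geometry ℛ using (fromℤ)
  open RingProperties ring
    using (-‿involutive; -0#≈0#; -‿+-comm; -‿distribʳ-*; -‿distribˡ-*)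
  open SetoidReasoning setoid
  private
    module U = Mult semiring
    module V = Mult′ semiring

  fromℤ-neg : ∀ i → fromℤ (ℤ.- i) ≈ - fromℤ i
  fromℤ-neg (+ 0)       = ≈-sym -0#≈0#
  fromℤ-neg (+ ℕ.suc n) = ≈-refl
  fromℤ-neg -[1+ n ]    = ≈-sym (-‿involutive _)

  -- Induction on both arguments; the successor step is (1 + x) - (1 + y) = x - y. It is rewritten
  -- by hand because the solver below is built on these laws.
  fromℤ-⊖ : ∀ m n → fromℤ (m ℤ.⊖ n) ≈ fromℤ (+ m) - fromℤ (+ n)
  fromℤ-⊖ m 0 = ≈-sym (≈-trans (+-congˡ -0#≈0#) (+-identityʳ _))
  fromℤ-⊖ 0 (ℕ.suc n) = ≈-sym (+-identityˡ _)
  fromℤ-⊖ (ℕ.suc m) (ℕ.suc n) = begin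
    fromℤ (ℕ.suc m ℤ.⊖ ℕ.suc n)      ≡⟨ ≡.cong fromℤ (ℤ.[1+m]⊖[1+n]≡m⊖n m n) ⟩
    fromℤ (m ℤ.⊖ n)                  ≈⟨ fromℤ-⊖ m n ⟩
    x - y                            ≈⟨ +-congʳ (+-identityˡ x) ⟨
    (0# + x) - y                     ≈⟨ +-congʳ (+-congʳ (-‿inverseʳ 1#)) ⟨
    ((1# - 1#) + x) - y              ≈⟨ +-congʳ (+-assoc 1# (- 1#) x) ⟩
    (1# + (- 1# + x)) - y            ≈⟨ +-congʳ (+-congˡ (+-comm (- 1#) x)) ⟩
    (1# + (x - 1#)) - y              ≈⟨ +-congʳ (+-assoc 1# x (- 1#)) ⟨
    ((1# + x) - 1#) - y              ≈⟨ +-assoc (1# + x) (- 1#) (- y) ⟩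
    (1# + x) + (- 1# - y)            ≈⟨ +-congˡ (-‿+-comm 1# y) ⟩
    (1# + x) - (1# + y)              ∎
    where x = fromℤ (+ m)
          y = fromℤ (+ n)

  fromℤ-+ : ∀ i j → fromℤ (i ℤ.+ j) ≈ fromℤ i + fromℤ j
  fromℤ-+ (+ m)    (+ n)    = U.×-homo-+ 1# m n
  fromℤ-+ (+ m)    -[1+ n ] = fromℤ-⊖ m (ℕ.suc n)
  fromℤ-+ -[1+ m ] (+ n)    = ≈-trans (fromℤ-⊖ n (ℕ.suc m)) (+-comm _ _)
  fromℤ-+ -[1+ m ] -[1+ n ] = begin
    fromℤ (-[1+ m ] ℤ.+ -[1+ n ])
      ≡⟨ ≡.cong fromℤ (ℤ.neg-distrib-+ (+ ℕ.suc m) (+ ℕ.suc n)) ⟨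
    fromℤ (ℤ.- (+ (ℕ.suc m ℕ.+ ℕ.suc n)))  ≈⟨ -‿cong (U.×-homo-+ 1# (ℕ.suc m) (ℕ.suc n)) ⟩
    - (fromℤ (+ ℕ.suc m) + fromℤ (+ ℕ.suc n))  ≈⟨ -‿+-comm _ _ ⟨
    fromℤ -[1+ m ] + fromℤ -[1+ n ]        ∎

  -- Isolating a non-negative left factor lets `fromℤ-*` treat a negative one by pulling out its
  -- sign.
  fromℤ-*ℕ : ∀ m j → fromℤ (+ m ℤ.* j) ≈ fromℤ (+ m) * fromℤ j
  fromℤ-*ℕ m (+ n) = begin
    fromℤ (+ m ℤ.* + n)  ≡⟨ ≡.cong fromℤ (ℤ.pos-* m n) ⟨
    fromℤ (+ (m ℕ.* n))  ≈⟨ U.×1-homo-* m n ⟩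
    fromℤ (+ m) * fromℤ (+ n) ∎
  fromℤ-*ℕ m -[1+ n ] = begin
    fromℤ (+ m ℤ.* -[1+ n ])            ≡⟨ ≡.cong fromℤ (ℤ.neg-distribʳ-* (+ m) (+ ℕ.suc n)) ⟨
    fromℤ (ℤ.- (+ m ℤ.* + ℕ.suc n))     ≈⟨ fromℤ-neg (+ m ℤ.* + ℕ.suc n) ⟩
    - fromℤ (+ m ℤ.* + ℕ.suc n)         ≈⟨ -‿cong (fromℤ-*ℕ m (+ ℕ.suc n)) ⟩
    - (fromℤ (+ m) * fromℤ (+ ℕ.suc n)) ≈⟨ -‿distribʳ-* _ _ ⟩
    fromℤ (+ m) * fromℤ -[1+ n ]        ∎

  fromℤ-* : ∀ i j → fromℤ (i ℤ.* j) ≈ fromℤ i * fromℤ j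
  fromℤ-* (+ m)    j = fromℤ-*ℕ m j
  fromℤ-* -[1+ m ] j = begin
    fromℤ (-[1+ m ] ℤ.* j)              ≡⟨ ≡.cong fromℤ (ℤ.neg-distribˡ-* (+ ℕ.suc m) j) ⟨
    fromℤ (ℤ.- (+ ℕ.suc m ℤ.* j))       ≈⟨ fromℤ-neg (+ ℕ.suc m ℤ.* j) ⟩
    - fromℤ (+ ℕ.suc m ℤ.* j)           ≈⟨ -‿cong (fromℤ-*ℕ (ℕ.suc m) j) ⟩
    - (fromℤ (+ ℕ.suc m) * fromℤ j)     ≈⟨ -‿distribˡ-* _ _ ⟩
    fromℤ -[1+ m ] * fromℤ j            ∎

  -- Unlike fromℤ, this sends 1 and 2 to terms definitionally equal to 1# and 1# + 1#,
  -- so that solver constants match the constants occurring in goals.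
  coeff : ℤ → Carrier
  coeff (+ n)    = n V.× 1#
  coeff -[1+ n ] = - (ℕ.suc n V.× 1#)

  fromℤ≈coeff : ∀ i → fromℤ i ≈ coeff i
  fromℤ≈coeff (+ n)    = V.×ᵤ≈× n 1#
  fromℤ≈coeff -[1+ n ] = -‿cong (V.×ᵤ≈× (ℕ.suc n) 1#)

  private
    ℤ-ring : RawRing _ _
    ℤ-ring = ℤ.+-*-rawRing

    homomorphism : ℤ-ring -Raw-AlmostCommutative⟶ fromCommutativeRing commutativeRing
    homomorphism = record
      { ⟦_⟧    = coeff
      ; +-homo = λ i j → transfer (i ℤ.+ j) (fromℤ-+ i j) (+-cong (fromℤ≈coeff i) (fromℤ≈coeff j))
      ; *-homo = λ i j → transfer (i ℤ.* j) (fromℤ-* i j) (*-cong (fromℤ≈coeff i) (fromℤ≈coeff j))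
      ; -‿homo = λ i → transfer (ℤ.- i) (fromℤ-neg i) (-‿cong (fromℤ≈coeff i))
      ; 0-homo = ≈-refl
      ; 1-homo = ≈-refl
      }
      where
      transfer : ∀ i {x y} → fromℤ i ≈ x → x ≈ y → coeff i ≈ y
      transfer i p q = ≈-trans (≈-sym (fromℤ≈coeff i)) (≈-trans p q)

    coeff-≟ : ∀ i j → Maybe (coeff i ≈ coeff j)
    coeff-≟ i j = map (λ { ≡.refl → ≈-refl }) (dec⇒weaklyDec ℤ._≟_ i j)

  open RingSolver ℤ-ring (fromCommutativeRing commutativeRing) homomorphism coeff-≟ public

-- Order, squares and inverses in the real field.

module OrderedField {c ℓ} (ℛ : Reals c ℓ) where
  open Reals ℛ
  open RealFacts ℛ using (2#)
  open Geometry ℛ using (_⁻¹; fromℤ)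
  open IntegerSolver ℛ

  ≤-resp : ∀ {x x′ y y′} → x ≈ x′ → y ≈ y′ → x ≤ y → x′ ≤ y′
  ≤-resp p q r = ≤-trans (≤-reflexive (≈-sym p)) (≤-trans r (≤-reflexive q))

  x≤y⇒0≤y-x : ∀ {x y} → x ≤ y → 0# ≤ y - x
  x≤y⇒0≤y-x {x} p = ≤-resp (-‿inverseʳ x) ≈-refl (+-monoˡ-≤ (- x) p)

  0≤y-x⇒x≤y : ∀ {x y} → 0# ≤ y - x → x ≤ y
  0≤y-x⇒x≤y {x} {y} p = ≤-resp (+-identityˡ x)
    (solve 2 (λ x y → (y :- x) :+ x := y) ≈-refl x y) (+-monoˡ-≤ x p)

  +-nonNeg : ∀ {x y} → 0# ≤ x → 0# ≤ y → 0# ≤ x + y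
  +-nonNeg {x} {y} p q = ≤-trans q (≤-resp (+-identityˡ y) ≈-refl (+-monoˡ-≤ y p))

  x≤0⇒0≤-x : ∀ {x} → x ≤ 0# → 0# ≤ - x
  x≤0⇒0≤-x p = ≤-resp ≈-refl (+-identityˡ _) (x≤y⇒0≤y-x p)

  sq-nonNeg : ∀ x → 0# ≤ x * x
  sq-nonNeg x with total 0# x
  ... | inj₁ p = *-nonNeg p p
  ... | inj₂ p = ≤-resp ≈-refl (solve 1 (λ x → (:- x) :* (:- x) := x :* x) ≈-refl x)
                   (*-nonNeg (x≤0⇒0≤-x p) (x≤0⇒0≤-x p))

  0≤1 : 0# ≤ 1#
  0≤1 = ≤-resp ≈-refl (*-identityˡ 1#) (sq-nonNeg 1#)

  0≤2 : 0# ≤ 2#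
  0≤2 = +-nonNeg 0≤1 0≤1

  -- If x ≤ 0 then x - 2x = -x ≥ 0, so 0 ≤ 2x ≤ x. This clears a factor 2 without dividing.
  halve-nonNeg : ∀ {x} → 0# ≤ 2# * x → 0# ≤ x
  halve-nonNeg {x} p with total 0# x
  ... | inj₁ q = q
  ... | inj₂ q = ≤-trans p
    (0≤y-x⇒x≤y (≤-resp ≈-refl
      (solve 1 (λ x → :- x := x :- con (+ 2) :* x) ≈-refl x) (x≤0⇒0≤-x q)))

  *-zero-cancelˡ : ∀ {x y} → ¬ x ≈ 0# → x * y ≈ 0# → y ≈ 0#
  *-zero-cancelˡ {x} {y} x≉0 xy≈0 with u , ux≈1 , _ ← invertible x x≉0 =
    ≈-trans (≈-sym (*-identityˡ y)) (≈-trans (*-congʳ (≈-sym ux≈1))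
      (≈-trans (*-assoc u x y) (≈-trans (*-congˡ xy≈0) (zeroʳ u))))

  sq≈0⇒≈0 : ∀ {x} → x * x ≈ 0# → x ≈ 0#
  sq≈0⇒≈0 {x} p with x ≟ 0#
  ... | yes q = q
  ... | no  q = *-zero-cancelˡ q p

  +≈0⇒≈0ˡ : ∀ {x y} → 0# ≤ x → 0# ≤ y → x + y ≈ 0# → x ≈ 0#
  +≈0⇒≈0ˡ {x} {y} p q e = antisym
    (0≤y-x⇒x≤y (≤-resp ≈-refl (≈-trans
      (solve 2 (λ x y → y := (x :+ y) :- x) ≈-refl x y) (+-congʳ e)) q)) p

  -- For 0 ≤ x ≤ 1 the product x(1 - x) is non-negative, so 1 ≤ x² ≤ x.
  1≤sq⇒1≤ : ∀ {x} → 0# ≤ x → 1# ≤ x * x → 1# ≤ x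
  1≤sq⇒1≤ {x} 0≤x p with total 1# x
  ... | inj₁ q = q
  ... | inj₂ q = ≤-trans p (0≤y-x⇒x≤y (≤-resp ≈-refl
    (solve 1 (λ x → x :* (con (+ 1) :- x) := x :- x :* x) ≈-refl x)
    (*-nonNeg 0≤x (x≤y⇒0≤y-x q))))

  1≤⇒1≤sq : ∀ {x} → 1# ≤ x → 1# ≤ x * x
  1≤⇒1≤sq {x} p = 0≤y-x⇒x≤y (≤-resp ≈-refl
    (solve 1 (λ x → (x :- con (+ 1)) :* (x :- con (+ 1)) :+ con (+ 2) :* (x :- con (+ 1))
                    := x :* x :- con (+ 1)) ≈-refl x)
    (+-nonNeg (sq-nonNeg _) (*-nonNeg 0≤2 (x≤y⇒0≤y-x p))))

  ⁻¹-inverseʳ : ∀ {x} → ¬ x ≈ 0# → x * x ⁻¹ ≈ 1#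
  ⁻¹-inverseʳ {x} x≉0 with x ≟ 0#
  ... | yes x≈0 = contradiction x≈0 x≉0
  ... | no  x≉0 = proj₂ (proj₂ (invertible x x≉0))

  ⁻¹-zero : ∀ {x} → x ≈ 0# → x ⁻¹ ≈ 0#
  ⁻¹-zero {x} x≈0 with x ≟ 0#
  ... | yes _   = ≈-refl
  ... | no  x≉0 = contradiction x≈0 x≉0

  ⁻¹-unique : ∀ {x y} → x * y ≈ 1# → x ⁻¹ ≈ y
  ⁻¹-unique {x} {y} xy≈1 = begin
    x ⁻¹            ≈⟨ *-identityʳ _ ⟨
    x ⁻¹ * 1#       ≈⟨ *-congˡ xy≈1 ⟨
    x ⁻¹ * (x * y)  ≈⟨ solve 3 (λ u x y → u :* (x :* y) := (x :* u) :* y) ≈-refl (x ⁻¹) x y ⟩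
    x * x ⁻¹ * y    ≈⟨ *-congʳ (⁻¹-inverseʳ x≉0) ⟩
    1# * y          ≈⟨ *-identityˡ y ⟩
    y               ∎
    where
    open SetoidReasoning setoid
    x≉0 : ¬ x ≈ 0#
    x≉0 e = 0≉1 (≈-trans (≈-sym (zeroˡ y)) (≈-trans (*-congʳ (≈-sym e)) xy≈1))

  -- `_⁻¹` branches on whether its argument is zero, so the branches taken for x and y have to be
  -- matched; in the zero case both give the default value 0.
  ⁻¹-cong : ∀ {x y} → x ≈ y → x ⁻¹ ≈ y ⁻¹
  ⁻¹-cong {x} {y} x≈y with y ≟ 0#
  ... | yes y≈0 = ⁻¹-zero (≈-trans x≈y y≈0)
  ... | no  y≉0 = ⁻¹-unique (≈-trans (*-congʳ x≈y) (proj₂ (proj₂ (invertible y y≉0))))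

  1⁻¹≈1 : ∀ {x} → x ≈ 1# → x ⁻¹ ≈ 1#
  1⁻¹≈1 p = ⁻¹-unique (≈-trans (*-congʳ p) (*-identityˡ 1#))

  -- For nonzero x, the inverse u satisfies u = x u².
  ⁻¹-nonNeg : ∀ {x} → 0# ≤ x → 0# ≤ x ⁻¹
  ⁻¹-nonNeg {x} 0≤x with x ≟ 0#
  ... | yes _ = ≤-refl
  ... | no x≉0 with u , _ , xu≈1 ← invertible x x≉0 =
    ≤-resp ≈-refl (≈-trans (solve 2 (λ u x → x :* (u :* u) := (x :* u) :* u) ≈-refl u x)
                     (≈-trans (*-congʳ xu≈1) (*-identityˡ u)))
      (*-nonNeg 0≤x (sq-nonNeg u))

  -- Because y - y/n = y (n - 1)/n.
  1≤n⇒yn⁻¹≤y : ∀ {y n} → 0# ≤ y → 1# ≤ n → y * n ⁻¹ ≤ y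
  1≤n⇒yn⁻¹≤y {y} {n} 0≤y 1≤n = 0≤y-x⇒x≤y (≤-resp ≈-refl
    (≈-trans (solve 3 (λ y n u → y :* ((n :- con (+ 1)) :* u) := y :* (n :* u) :- y :* u) ≈-refl y n (n ⁻¹))
             (+-congʳ (≈-trans (*-congˡ (⁻¹-inverseʳ n≉0)) (*-identityʳ y))))
    (*-nonNeg 0≤y (*-nonNeg (x≤y⇒0≤y-x 1≤n) (⁻¹-nonNeg (≤-trans 0≤1 1≤n)))))
    where
    n≉0 : ¬ n ≈ 0#
    n≉0 e = 0≉1 (antisym 0≤1 (≤-resp ≈-refl e 1≤n))

  -- Multiplying y/n ≤ y by n gives y(n - 1) ≥ 0. If n ≤ 1 then also y(n - 1) ≤ 0, and y ≠ 0 leaves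
  -- only n = 1.
  yn⁻¹≤y⇒1≤n : ∀ {y n} → 0# < y → 0# < n → y * n ⁻¹ ≤ y → 1# ≤ n
  yn⁻¹≤y⇒1≤n {y} {n} (0≤y , 0≉y) (0≤n , 0≉n) p with total 1# n
  ... | inj₁ q = q
  ... | inj₂ q = ≤-reflexive (≈-trans (≈-sym (+-identityʳ 1#)) (≈-trans (+-congˡ (≈-sym n-1≈0))
      (solve 1 (λ n → con (+ 1) :+ (n :- con (+ 1)) := n) ≈-refl n)))
    where
    n≉0 : ¬ n ≈ 0#
    n≉0 e = 0≉n (≈-sym e)
    0≤yn-y : 0# ≤ y * (n - 1#)
    0≤yn-y = ≤-resp ≈-refl
      (≈-trans (solve 3 (λ y n u → n :* (y :- y :* u) := y :* n :- y :* (n :* u)) ≈-refl y n (n ⁻¹))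
        (≈-trans (+-congˡ (-‿cong (*-congˡ (⁻¹-inverseʳ n≉0))))
          (solve 2 (λ y n → y :* n :- y :* con (+ 1) := y :* (n :- con (+ 1))) ≈-refl y n)))
      (*-nonNeg 0≤n (x≤y⇒0≤y-x p))
    yn-y≤0 : y * (n - 1#) ≤ 0#
    yn-y≤0 = 0≤y-x⇒x≤y (≤-resp ≈-refl
      (solve 2 (λ y n → y :* (con (+ 1) :- n) := con (+ 0) :- y :* (n :- con (+ 1))) ≈-refl y n)
      (*-nonNeg 0≤y (x≤y⇒0≤y-x q)))
    n-1≈0 : n - 1# ≈ 0#
    n-1≈0 = *-zero-cancelˡ (λ e → 0≉y (≈-sym e)) (antisym yn-y≤0 0≤yn-y)

  1≤fromℤ[1+n] : ∀ n → 1# ≤ fromℤ (+ ℕ.suc n)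
  1≤fromℤ[1+n] 0         = ≤-reflexive (≈-sym (+-identityʳ 1#))
  1≤fromℤ[1+n] (ℕ.suc n) = ≤-trans (1≤fromℤ[1+n] n)
    (≤-resp (+-identityˡ _) ≈-refl (+-monoˡ-≤ _ 0≤1))

  -- The discreteness of the integers, from which the lower bounds on bottom rows of `Γ` descend.
  fromℤ-sq : ∀ i → fromℤ i ≈ 0# ⊎ 1# ≤ fromℤ i * fromℤ i
  fromℤ-sq (+ 0)       = inj₁ ≈-refl
  fromℤ-sq (+ ℕ.suc n) = inj₂ (1≤⇒1≤sq (1≤fromℤ[1+n] n))
  fromℤ-sq -[1+ n ]    = inj₂ (≤-resp ≈-refl
    (solve 1 (λ x → x :* x := (:- x) :* (:- x)) ≈-refl (fromℤ (+ ℕ.suc n)))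
    (1≤⇒1≤sq (1≤fromℤ[1+n] n)))

-- Complex, matrix and quaternion arithmetic.

module ComplexAlgebra {c ℓ} (ℛ : Reals c ℓ) where
  open Reals ℛ
  open RealFacts ℛ using (2#)
  open Geometry ℛ
  open IntegerSolver ℛ
  open OrderedField ℛ

  -- Expressions mirroring ℂ and M₂ componentwise, so that the real solver
  -- proves complex and matrix identities.
  infixl 6 _⊕_ _⊞_
  infixl 7 _⊗_ _⊠_ _⊡_

  ℂₚ : ℕ → Set
  ℂₚ n = Polynomial n × Polynomial n

  _⊕_ _⊗_ : ∀ {n} → ℂₚ n → ℂₚ n → ℂₚ n
  (a , b) ⊕ (a′ , b′) = a :+ a′ , b :+ b′
  (a , b) ⊗ (a′ , b′) = a :* a′ :- b :* b′ , a :* b′ :+ b :* a′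

  ⊖_ : ∀ {n} → ℂₚ n → ℂₚ n
  ⊖ (a , b) = :- a , :- b

  0ₚ 1ₚ iₚ : ∀ {n} → ℂₚ n
  0ₚ = con (+ 0) , con (+ 0)
  1ₚ = con (+ 1) , con (+ 0)
  iₚ = con (+ 0) , con (+ 1)

  record M₂ₚ (n : ℕ) : Set where
    constructor matₚ
    field
      m₁₁ m₁₂ m₂₁ m₂₂ : ℂₚ n

  _⊠_ : ∀ {n} → M₂ₚ n → M₂ₚ n → M₂ₚ n
  matₚ a b c d ⊠ matₚ a′ b′ c′ d′ =
    matₚ (a ⊗ a′ ⊕ b ⊗ c′) (a ⊗ b′ ⊕ b ⊗ d′) (c ⊗ a′ ⊕ d ⊗ c′) (c ⊗ b′ ⊕ d ⊗ d′)

  _⊞_ : ∀ {n} → M₂ₚ n → M₂ₚ n → M₂ₚ n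
  matₚ a b c d ⊞ matₚ a′ b′ c′ d′ = matₚ (a ⊕ a′) (b ⊕ b′) (c ⊕ c′) (d ⊕ d′)

  _⊡_ : ∀ {n} → ℂₚ n → M₂ₚ n → M₂ₚ n
  z ⊡ matₚ a b c d = matₚ (z ⊗ a) (z ⊗ b) (z ⊗ c) (z ⊗ d)

  adjₚ : ∀ {n} → M₂ₚ n → M₂ₚ n
  adjₚ (matₚ a b c d) = matₚ d (⊖ b) (⊖ c) a

  basisₚ : ∀ {n} → Fin 3 → M₂ₚ n
  basisₚ 𝟎 = matₚ 0ₚ 1ₚ 1ₚ 0ₚ
  basisₚ 𝟏 = matₚ 0ₚ iₚ (⊖ iₚ) 0ₚ
  basisₚ 𝟐 = matₚ 1ₚ 0ₚ 0ₚ (⊖ 1ₚ)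

  ℍₚ : ℕ → Set
  ℍₚ n = Polynomial n × Polynomial n × Polynomial n × Polynomial n

  _⊕ℍ_ _⊗ℍ_ : ∀ {n} → ℍₚ n → ℍₚ n → ℍₚ n
  (a , b , c , d) ⊕ℍ (a′ , b′ , c′ , d′) = a :+ a′ , b :+ b′ , c :+ c′ , d :+ d′
  (a , b , c , d) ⊗ℍ (a′ , b′ , c′ , d′) =
      a :* a′ :- b :* b′ :- c :* c′ :- d :* d′
    , a :* b′ :+ b :* a′ :+ c :* d′ :- d :* c′
    , a :* c′ :- b :* d′ :+ c :* a′ :+ d :* b′
    , a :* d′ :+ b :* c′ :- c :* b′ :+ d :* a′

  affineₚ : ∀ {n} → ℂₚ n → ℂₚ n → ℍₚ n → ℍₚ n
  affineₚ (a₁ , a₂) (b₁ , b₂) z =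
    ((a₁ , a₂ , con (+ 0) , con (+ 0)) ⊗ℍ z) ⊕ℍ (b₁ , b₂ , con (+ 0) , con (+ 0))

  normₚ : ∀ {n} → ℍₚ n → Polynomial n
  normₚ (a , b , c , d) = a :* a :+ b :* b :+ c :* c :+ d :* d

  -- The second argument stands for the inverse of the norm.
  invₚ : ∀ {n} → ℍₚ n → Polynomial n → ℍₚ n
  invₚ (a , b , c , d) u = a :* u , :- b :* u , :- c :* u , :- d :* u

  ∣_∣²ₚ : ∀ {n} → ℂₚ n → Polynomial n
  ∣ a , b ∣²ₚ = a :* a :+ b :* b

  jₚ : ∀ {n} → ℍₚ n → Polynomial n
  jₚ (_ , _ , y , _) = y

  ⟦_⟧ℂ : ∀ {n} → ℂₚ n → Vec Carrier n → ℂ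
  ⟦ p , q ⟧ℂ ρ = ⟦ p ⟧ ρ +i ⟦ q ⟧ ρ

  proveℂ : ∀ {n} (ρ : Vec Carrier n) (z w : ℂₚ n) →
           ⟦ proj₁ z ⟧↓ ρ ≈ ⟦ proj₁ w ⟧↓ ρ → ⟦ proj₂ z ⟧↓ ρ ≈ ⟦ proj₂ w ⟧↓ ρ →
           ⟦ z ⟧ℂ ρ ≈ℂ ⟦ w ⟧ℂ ρ
  proveℂ ρ (p , q) (p′ , q′) e e′ = prove ρ p p′ e , prove ρ q q′ e′

  ⟦_⟧M : ∀ {n} → M₂ₚ n → Vec Carrier n → M₂
  ⟦ matₚ a b c d ⟧M ρ = mat (⟦ a ⟧ℂ ρ) (⟦ b ⟧ℂ ρ) (⟦ c ⟧ℂ ρ) (⟦ d ⟧ℂ ρ)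

  -- Identities modulo a relation t = 1, homogenised by the factor t.
  module Modulo {n} (ρ : Vec Carrier n) (t : Polynomial n) (t≈1 : ⟦ t ⟧ ρ ≈ 1#) where

    infix 4 _≗_ _≗ℂ_ _≗M_

    _≗_ : Polynomial n → Polynomial n → Set ℓ
    p ≗ q = ⟦ p ⟧↓ ρ ≈ ⟦ t :* q ⟧↓ ρ

    _≗ℂ_ : ℂₚ n → ℂₚ n → Set ℓ
    (p , q) ≗ℂ (p′ , q′) = p ≗ p′ × q ≗ q′

    _≗M_ : M₂ₚ n → M₂ₚ n → Set ℓ
    matₚ a b c d ≗M matₚ a′ b′ c′ d′ = a ≗ℂ a′ × b ≗ℂ b′ × c ≗ℂ c′ × d ≗ℂ d′

    prove-mod : ∀ p q → p ≗ q → ⟦ p ⟧ ρ ≈ ⟦ q ⟧ ρ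
    prove-mod p q e = ≈-trans (prove ρ p (t :* q) e) (≈-trans (*-congʳ t≈1) (*-identityˡ _))

    proveℂ-mod : ∀ z w → z ≗ℂ w → ⟦ z ⟧ℂ ρ ≈ℂ ⟦ w ⟧ℂ ρ
    proveℂ-mod (p , q) (p′ , q′) (e , e′) = prove-mod p p′ e , prove-mod q q′ e′

    proveM-mod : ∀ A B → A ≗M B → ⟦ A ⟧M ρ ≈M ⟦ B ⟧M ρ
    proveM-mod (matₚ a b c d) (matₚ a′ b′ c′ d′) (p , q , r , s) =
      proveℂ-mod a a′ p , proveℂ-mod b b′ q , proveℂ-mod c c′ r , proveℂ-mod d d′ s

  ≈ℂ-refl : ∀ {z} → z ≈ℂ z
  ≈ℂ-refl = ≈-refl , ≈-refl

  ≈ℂ-sym : ∀ {z w} → z ≈ℂ w → w ≈ℂ z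
  ≈ℂ-sym (p , q) = ≈-sym p , ≈-sym q

  ≈ℂ-trans : ∀ {z w v} → z ≈ℂ w → w ≈ℂ v → z ≈ℂ v
  ≈ℂ-trans (p , q) (p′ , q′) = ≈-trans p p′ , ≈-trans q q′

  +ℂ-cong : ∀ {z z′ w w′} → z ≈ℂ z′ → w ≈ℂ w′ → z +ℂ w ≈ℂ z′ +ℂ w′
  +ℂ-cong (p , q) (p′ , q′) = +-cong p p′ , +-cong q q′

  *ℂ-cong : ∀ {z z′ w w′} → z ≈ℂ z′ → w ≈ℂ w′ → z *ℂ w ≈ℂ z′ *ℂ w′
  *ℂ-cong (p , q) (p′ , q′) =
    +-cong (*-cong p p′) (-‿cong (*-cong q q′)) , +-cong (*-cong p q′) (*-cong q p′)

  -ℂ-cong : ∀ {z z′} → z ≈ℂ z′ → -ℂ z ≈ℂ -ℂ z′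
  -ℂ-cong (p , q) = -‿cong p , -‿cong q

  ∣_∣² : ℂ → Carrier
  ∣ z ∣² = re z * re z + im z * im z

  ∣∣²-cong : ∀ {z w} → z ≈ℂ w → ∣ z ∣² ≈ ∣ w ∣²
  ∣∣²-cong (p , q) = +-cong (*-cong p p) (*-cong q q)

  ∣∣²-nonNeg : ∀ z → 0# ≤ ∣ z ∣²
  ∣∣²-nonNeg z = +-nonNeg (sq-nonNeg (re z)) (sq-nonNeg (im z))

  ∣∣²≈0⇒≈0 : ∀ z → ∣ z ∣² ≈ 0# → z ≈ℂ 0ℂ
  ∣∣²≈0⇒≈0 (x +i y) p =
      sq≈0⇒≈0 (+≈0⇒≈0ˡ (sq-nonNeg x) (sq-nonNeg y) p)
    , sq≈0⇒≈0 (+≈0⇒≈0ˡ (sq-nonNeg y) (sq-nonNeg x) (≈-trans (+-comm _ _) p))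

  ⁻¹ℂ-cong : ∀ {z w} → z ≈ℂ w → z ⁻¹ℂ ≈ℂ w ⁻¹ℂ
  ⁻¹ℂ-cong z≈w@(p , q) = *-cong p n , *-cong (-‿cong q) n
    where n = ⁻¹-cong (∣∣²-cong z≈w)

  det-cong : ∀ {g g′} → g ≈M g′ → det g ≈ℂ det g′
  det-cong (a , b , c , d) = +ℂ-cong (*ℂ-cong a d) (-ℂ-cong (*ℂ-cong b c))

  ·₂-cong : ∀ {g g′ z} → g ≈M g′ → g ·₂ z ≈ℂ g′ ·₂ z
  ·₂-cong (a , b , c , d) = *ℂ-cong (+ℂ-cong (*ℂ-cong a ≈ℂ-refl) b)
    (⁻¹ℂ-cong (+ℂ-cong (*ℂ-cong c ≈ℂ-refl) d))

  fromℂ-cong : ∀ {z w} → z ≈ℂ w → fromℂ z ≈ℍ fromℂ w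
  fromℂ-cong (p , q) = p , q , ≈-refl , ≈-refl

  +ℍ-cong : ∀ {p p′ q q′} → p ≈ℍ p′ → q ≈ℍ q′ → p +ℍ q ≈ℍ p′ +ℍ q′
  +ℍ-cong (a , b , c , d) (a′ , b′ , c′ , d′) =
    +-cong a a′ , +-cong b b′ , +-cong c c′ , +-cong d d′

  *ℍ-cong : ∀ {p p′ q q′} → p ≈ℍ p′ → q ≈ℍ q′ → p *ℍ q ≈ℍ p′ *ℍ q′
  *ℍ-cong (a , b , c , d) (a′ , b′ , c′ , d′) =
      +-cong (+-cong (+-cong (*-cong a a′) (-‿cong (*-cong b b′))) (-‿cong (*-cong c c′))) (-‿cong (*-cong d d′))
    , +-cong (+-cong (+-cong (*-cong a b′) (*-cong b a′)) (*-cong c d′)) (-‿cong (*-cong d c′))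
    , +-cong (+-cong (+-cong (*-cong a c′) (-‿cong (*-cong b d′))) (*-cong c a′)) (*-cong d b′)
    , +-cong (+-cong (+-cong (*-cong a d′) (*-cong b c′)) (-‿cong (*-cong c b′))) (*-cong d a′)

  ⁻¹ℍ-cong : ∀ {p q} → p ≈ℍ q → p ⁻¹ℍ ≈ℍ q ⁻¹ℍ
  ⁻¹ℍ-cong (a , b , c , d) =
    *-cong a n , *-cong (-‿cong b) n , *-cong (-‿cong c) n , *-cong (-‿cong d) n
    where n = ⁻¹-cong (+-cong (+-cong (+-cong (*-cong a a) (*-cong b b)) (*-cong c c)) (*-cong d d))

  ≈ℍ-refl : ∀ {p} → p ≈ℍ p
  ≈ℍ-refl = ≈-refl , ≈-refl , ≈-refl , ≈-refl

  ≈ℍ-sym : ∀ {p q} → p ≈ℍ q → q ≈ℍ p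
  ≈ℍ-sym (a , b , c , d) = ≈-sym a , ≈-sym b , ≈-sym c , ≈-sym d

  ≈ℍ-trans : ∀ {p q r} → p ≈ℍ q → q ≈ℍ r → p ≈ℍ r
  ≈ℍ-trans (a , b , c , d) (a′ , b′ , c′ , d′) =
    ≈-trans a a′ , ≈-trans b b′ , ≈-trans c c′ , ≈-trans d d′

  affine-cong : ∀ {a a′ b b′ z z′} → a ≈ℂ a′ → b ≈ℂ b′ → z ≈ℍ z′ →
                fromℂ a *ℍ z +ℍ fromℂ b ≈ℍ fromℂ a′ *ℍ z′ +ℍ fromℂ b′
  affine-cong a b z = +ℍ-cong (*ℍ-cong (fromℂ-cong a) z) (fromℂ-cong b)

  ·-cong : ∀ {g g′ z z′} → g ≈M g′ → z ≈ℍ z′ → g · z ≈ℍ g′ · z′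
  ·-cong (a , b , c , d) z = *ℍ-cong (affine-cong a b z) (⁻¹ℍ-cong (affine-cong c d z))

  ≈M-refl : ∀ {g} → g ≈M g
  ≈M-refl = ≈ℂ-refl , ≈ℂ-refl , ≈ℂ-refl , ≈ℂ-refl

  ≈M-trans : ∀ {f g h} → f ≈M g → g ≈M h → f ≈M h
  ≈M-trans (a , b , c , d) (a′ , b′ , c′ , d′) =
    ≈ℂ-trans a a′ , ≈ℂ-trans b b′ , ≈ℂ-trans c c′ , ≈ℂ-trans d d′

  *M-cong : ∀ {f f′ g g′} → f ≈M f′ → g ≈M g′ → f *M g ≈M f′ *M g′
  *M-cong (a , b , c , d) (a′ , b′ , c′ , d′) =
      +ℂ-cong (*ℂ-cong a a′) (*ℂ-cong b c′) , +ℂ-cong (*ℂ-cong a b′) (*ℂ-cong b d′)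
    , +ℂ-cong (*ℂ-cong c a′) (*ℂ-cong d c′) , +ℂ-cong (*ℂ-cong c b′) (*ℂ-cong d d′)

  -- The height of a transformed point.

  den : M₂ → Carrier → Carrier → Carrier
  den g x y = ∣ m₂₁ g *ℂ fromℝ x +ℂ m₂₂ g ∣² + ∣ m₂₁ g ∣² * (y * y)

  den-cong : ∀ {g g′ x y} → g ≈M g′ → den g x y ≈ den g′ x y
  den-cong (_ , _ , c , d) = +-cong (∣∣²-cong (+ℂ-cong (*ℂ-cong c ≈ℂ-refl) d))
    (*-congʳ (∣∣²-cong c))

  -- `den` is |cz + d|² for z = x + yj. In (az + b) times the conjugate of cz + d, the terms
  -- containing j add up to (ad - bc)yj, whose j-coordinate is y times the real part of the
  -- determinant. The inverse of the norm enters the solver as an independent variable.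
  yℍ-· : ∀ g {z} → q₁ z ≈ 0# → q₃ z ≈ 0# →
         yℍ (g · z) ≈ (yℍ z * re (det g)) * den g (q₀ z) (yℍ z) ⁻¹
  yℍ-· g@(mat a b c d) {z@(quat x _ y _)} q₁≈0 q₃≈0 =
    ≈-trans (proj₁ (proj₂ (proj₂ (·-cong (≈M-refl {g}) (≈-refl , q₁≈0 , ≈-refl , q₃≈0)))))
      (≈-trans
        (solve 11 (λ a₁ a₂ b₁ b₂ c₁ c₂ d₁ d₂ x y u →
          let z = x , con (+ 0) , y , con (+ 0)
          in jₚ (affineₚ (a₁ , a₂) (b₁ , b₂) z ⊗ℍ invₚ (affineₚ (c₁ , c₂) (d₁ , d₂) z) u)
             := (y :* ((a₁ :* d₁ :- a₂ :* d₂) :+ :- (b₁ :* c₁ :- b₂ :* c₂))) :* u)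
          ≈-refl (re a) (im a) (re b) (im b) (re c) (im c) (re d) (im d) x y (n ⁻¹))
        (*-congˡ (⁻¹-cong n≈den)))
    where
    v = fromℂ c *ℍ quat x 0# y 0# +ℍ fromℂ d
    n = q₀ v * q₀ v + q₁ v * q₁ v + q₂ v * q₂ v + q₃ v * q₃ v
    n≈den : n ≈ den g x y
    n≈den = solve 6 (λ c₁ c₂ d₁ d₂ x y →
        normₚ (affineₚ (c₁ , c₂) (d₁ , d₂) (x , con (+ 0) , y , con (+ 0)))
        := ∣ (c₁ , c₂) ⊗ (x , con (+ 0)) ⊕ (d₁ , d₂) ∣²ₚ :+ ∣ c₁ , c₂ ∣²ₚ :* (y :* y))
      ≈-refl (re c) (im c) (re d) (im d) x y

  im-·₂ : ∀ g z → IsReal (m₁₁ g) × IsReal (m₁₂ g) × IsReal (m₂₁ g) × IsReal (m₂₂ g) →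
          im (g ·₂ z) ≈ (im z * re (det g)) * den g (re z) (im z) ⁻¹
  im-·₂ g@(mat a b c d) (x +i y) (a₂≈0 , b₂≈0 , c₂≈0 , d₂≈0) =
    ≈-trans (proj₂ (·₂-cong {g} {gᵣ} {x +i y} g≈gᵣ))
      (≈-trans
        (solve 7 (λ a b c d x y u →
          let num = (a , con (+ 0)) ⊗ (x , y) ⊕ (b , con (+ 0))
              (v₁ , v₂) = (c , con (+ 0)) ⊗ (x , y) ⊕ (d , con (+ 0))
          in proj₂ (num ⊗ (v₁ :* u , :- v₂ :* u))
             := (y :* proj₁ ((a , con (+ 0)) ⊗ (d , con (+ 0)) ⊕ (⊖ ((b , con (+ 0)) ⊗ (c , con (+ 0)))))) :* u)
          ≈-refl (re a) (re b) (re c) (re d) x y (n ⁻¹))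
        (*-cong (*-congˡ (≈-sym (proj₁ (det-cong {g} {gᵣ} g≈gᵣ))))
                (⁻¹-cong (≈-trans n≈den (≈-sym (den-cong {g} {gᵣ} g≈gᵣ))))))
    where
    -- The entries are replaced by `fromℝ` values so that their imaginary parts are the literal
    -- constant 0 for the solver.
    gᵣ = mat (fromℝ (re a)) (fromℝ (re b)) (fromℝ (re c)) (fromℝ (re d))
    g≈gᵣ : g ≈M gᵣ
    g≈gᵣ = (≈-refl , a₂≈0) , (≈-refl , b₂≈0) , (≈-refl , c₂≈0) , (≈-refl , d₂≈0)
    n = ∣ fromℝ (re c) *ℂ (x +i y) +ℂ fromℝ (re d) ∣²
    n≈den : n ≈ den gᵣ x y
    n≈den = solve 4 (λ c d x y →
        ∣ (c , con (+ 0)) ⊗ (x , y) ⊕ (d , con (+ 0)) ∣²ₚ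
        := ∣ (c , con (+ 0)) ⊗ (x , con (+ 0)) ⊕ (d , con (+ 0)) ∣²ₚ :+ ∣ c , con (+ 0) ∣²ₚ :* (y :* y))
      ≈-refl (re c) (re d) x y

-- Gaussian integers and the length of a bottom row.

module GaussianIntegers {c ℓ} (ℛ : Reals c ℓ) where
  open Reals ℛ
  open Geometry ℛ
  open IntegerSolver ℛ
  open OrderedField ℛ
  open ComplexAlgebra ℛ

  +-gaussian : ∀ {z w} → z ∈ IsGaussianInteger → w ∈ IsGaussianInteger → z +ℂ w ∈ IsGaussianInteger
  +-gaussian (m , n , p , q) (m′ , n′ , p′ , q′) = m ℤ.+ m′ , n ℤ.+ n′ ,
    ≈-trans (+-cong p p′) (≈-sym (fromℤ-+ m m′)) , ≈-trans (+-cong q q′) (≈-sym (fromℤ-+ n n′))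

  neg-gaussian : ∀ {z} → z ∈ IsGaussianInteger → -ℂ z ∈ IsGaussianInteger
  neg-gaussian (m , n , p , q) = ℤ.- m , ℤ.- n ,
    ≈-trans (-‿cong p) (≈-sym (fromℤ-neg m)) , ≈-trans (-‿cong q) (≈-sym (fromℤ-neg n))

  *-gaussian : ∀ {z w} → z ∈ IsGaussianInteger → w ∈ IsGaussianInteger → z *ℂ w ∈ IsGaussianInteger
  *-gaussian (m , n , p , q) (m′ , n′ , p′ , q′) =
    m ℤ.* m′ ℤ.+ ℤ.- (n ℤ.* n′) , m ℤ.* n′ ℤ.+ n ℤ.* m′ ,
    ≈-trans (+-cong (*-cong p p′) (-‿cong (*-cong q q′)))
      (≈-sym (≈-trans (fromℤ-+ (m ℤ.* m′) _)
        (+-cong (fromℤ-* m m′) (≈-trans (fromℤ-neg (n ℤ.* n′)) (-‿cong (fromℤ-* n n′)))))) ,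
    ≈-trans (+-cong (*-cong p q′) (*-cong q p′))
      (≈-sym (≈-trans (fromℤ-+ (m ℤ.* n′) _) (+-cong (fromℤ-* m n′) (fromℤ-* n m′))))

  ≈-gaussian : ∀ {z w} → z ≈ℂ w → z ∈ IsGaussianInteger → w ∈ IsGaussianInteger
  ≈-gaussian z≈w (m , n , z≈) = m , n , ≈ℂ-trans (≈ℂ-sym z≈w) z≈

  0-gaussian : 0ℂ ∈ IsGaussianInteger
  0-gaussian = + 0 , + 0 , ≈-refl , ≈-refl

  1-gaussian : 1ℂ ∈ IsGaussianInteger
  1-gaussian = + 1 , + 0 , ≈-sym (+-identityʳ 1#) , ≈-refl

  i-gaussian : iℂ ∈ IsGaussianInteger
  i-gaussian = + 0 , + 1 , ≈-refl , ≈-sym (+-identityʳ 1#)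

  -- Here |z|² = m² + n², and a single nonzero square already contributes 1.
  gaussian-∣∣² : ∀ {z} → z ∈ IsGaussianInteger → z ≈ℂ 0ℂ ⊎ 1# ≤ ∣ z ∣²
  gaussian-∣∣² {z} (m , n , p , q) with fromℤ-sq m | fromℤ-sq n
  ... | inj₁ m≈0 | inj₁ n≈0 = inj₁ (≈-trans p m≈0 , ≈-trans q n≈0)
  ... | inj₂ 1≤m | _        = inj₂ (≤-trans 1≤m (0≤y-x⇒x≤y (≤-resp ≈-refl
    (≈-trans (solve 2 (λ x y → y := (x :+ y) :- x) ≈-refl (re z * re z) (im z * im z))
      (+-congˡ (-‿cong (*-cong p p)))) (sq-nonNeg (im z)))))
  ... | inj₁ _   | inj₂ 1≤n = inj₂ (≤-trans 1≤n (0≤y-x⇒x≤y (≤-resp ≈-refl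
    (≈-trans (solve 2 (λ x y → x := (x :+ y) :- y) ≈-refl (re z * re z) (im z * im z))
      (+-congˡ (-‿cong (*-cong q q)))) (sq-nonNeg (re z)))))

  -- A zero bottom row would make the determinant 0. This supplies the non-degeneracy hypothesis of
  -- `1≤row`.
  unimodular-row≉0 : ∀ a b {c d} → det (mat a b c d) ≈ℂ 1ℂ → ¬ ∣ c ∣² + ∣ d ∣² ≈ 0#
  unimodular-row≉0 a b {c} {d} det≈1 e = 0≉1 (proj₁ (≈ℂ-trans (≈ℂ-sym det≈0) det≈1))
    where
    c≈0 : c ≈ℂ 0ℂ
    c≈0 = ∣∣²≈0⇒≈0 c (+≈0⇒≈0ˡ (∣∣²-nonNeg c) (∣∣²-nonNeg d) e)
    d≈0 : d ≈ℂ 0ℂ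
    d≈0 = ∣∣²≈0⇒≈0 d (+≈0⇒≈0ˡ (∣∣²-nonNeg d) (∣∣²-nonNeg c) (≈-trans (+-comm _ _) e))
    det≈0 : det (mat a b c d) ≈ℂ 0ℂ
    det≈0 = ≈ℂ-trans (+ℂ-cong (*ℂ-cong (≈ℂ-refl {a}) d≈0) (-ℂ-cong (*ℂ-cong (≈ℂ-refl {b}) c≈0)))
      (proveℂ (re a ∷ im a ∷ re b ∷ im b ∷ [])
        ((var 𝟎 , var 𝟏) ⊗ 0ₚ ⊕ (⊖ ((var 𝟐 , var 𝟑) ⊗ 0ₚ)))
        0ₚ ≈-refl ≈-refl)

  private
    row : ∀ {n} → Polynomial n → Polynomial n → Polynomial n → Polynomial n → Polynomial n
    row c₁ c₂ d₁ d₂ = ∣ c₁ , c₂ ∣²ₚ :+ ∣ d₁ , d₂ ∣²ₚ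

  -- With N = |c|² + |d|², both |c² + d|²|² and |2cd|² are at most N², while
  -- N² + 4 Re(c d̄)² = |c² + d²|² + |2cd|² prevents both from vanishing.
  1≤row : ∀ c d → c *ℂ c +ℂ d *ℂ d ∈ IsGaussianInteger → c *ℂ d +ℂ c *ℂ d ∈ IsGaussianInteger →
          ¬ ∣ c ∣² + ∣ d ∣² ≈ 0# → 1# ≤ ∣ c ∣² + ∣ d ∣²
  1≤row c d P∈ Q∈ N≉0 with gaussian-∣∣² P∈ | gaussian-∣∣² Q∈
  ... | inj₂ 1≤P | _ = 1≤sq⇒1≤ (+-nonNeg (∣∣²-nonNeg c) (∣∣²-nonNeg d)) (≤-trans 1≤P
    (0≤y-x⇒x≤y (≤-resp ≈-refl
      (solve 4 (λ c₁ c₂ d₁ d₂ →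
         let C = c₁ , c₂ ; D = d₁ , d₂ ; K = con (+ 2) :* (c₁ :* d₂ :- c₂ :* d₁) ; N = row c₁ c₂ d₁ d₂
         in K :* K := N :* N :- ∣ C ⊗ C ⊕ D ⊗ D ∣²ₚ)
        ≈-refl (re c) (im c) (re d) (im d))
      (sq-nonNeg _))))
  ... | inj₁ _ | inj₂ 1≤Q = 1≤sq⇒1≤ (+-nonNeg (∣∣²-nonNeg c) (∣∣²-nonNeg d)) (≤-trans 1≤Q
    (0≤y-x⇒x≤y (≤-resp ≈-refl
      (solve 4 (λ c₁ c₂ d₁ d₂ →
         let C = c₁ , c₂ ; D = d₁ , d₂ ; K = ∣ C ∣²ₚ :- ∣ D ∣²ₚ ; N = row c₁ c₂ d₁ d₂
         in K :* K := N :* N :- ∣ C ⊗ D ⊕ C ⊗ D ∣²ₚ)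
        ≈-refl (re c) (im c) (re d) (im d))
      (sq-nonNeg _))))
  ... | inj₁ P≈0 | inj₁ Q≈0 = contradiction (sq≈0⇒≈0 (+≈0⇒≈0ˡ (sq-nonNeg _) (sq-nonNeg _)
    (≈-trans
      (solve 4 (λ c₁ c₂ d₁ d₂ →
         let C = c₁ , c₂ ; D = d₁ , d₂ ; K = con (+ 2) :* (c₁ :* d₁ :+ c₂ :* d₂) ; N = row c₁ c₂ d₁ d₂
         in N :* N :+ K :* K := ∣ C ⊗ C ⊕ D ⊗ D ∣²ₚ :+ ∣ C ⊗ D ⊕ C ⊗ D ∣²ₚ)
        ≈-refl (re c) (im c) (re d) (im d))
      (≈-trans (+-cong (∣∣²-cong P≈0) (∣∣²-cong Q≈0))
        (prove [] (∣ 0ₚ ∣²ₚ :+ ∣ 0ₚ ∣²ₚ) (con (+ 0)) ≈-refl))))) N≉0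

-- Height bounds valid for all of `Γ`.

module Heights {r ℓ} (ℛ : Reals r ℓ) where
  open Reals ℛ
  open RealFacts ℛ using (2#; √2; √2*√2≈2)
  open Geometry ℛ
  open IntegerSolver ℛ
  open OrderedField ℛ
  open ComplexAlgebra ℛ
  open GaussianIntegers ℛ

  module _ {g : M₂} (g∈Γ : g ∈ Γ) where
    private
      a = m₁₁ g
      b = m₁₂ g
      c = m₂₁ g
      d = m₂₂ g

      -- The lower-left entries of X₁, X₂, Y are 1, -i, 0, so this entry is a combination of entries
      -- of 𝐜(g) with Gaussian coefficients.
      m₂₁-gaussian : ∀ j → m₂₁ (g *M basis j *M g ⁻¹M) ∈ IsGaussianInteger
      m₂₁-gaussian j = let _ , A , isC , _ , A∈ = g∈Γ in
        ≈-gaussian (≈ℂ-sym (proj₁ (proj₂ (proj₂ (isC j)))))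
          (+-gaussian (+-gaussian (*-gaussian (A∈ 𝟎 j) 1-gaussian)
                                  (*-gaussian (A∈ 𝟏 j) (neg-gaussian i-gaussian)))
                      (*-gaussian (A∈ 𝟐 j) 0-gaussian))

      ρ : Vec Carrier 4
      ρ = re c ∷ im c ∷ re d ∷ im d ∷ []

      cₚ dₚ : ℂₚ 4
      cₚ = var 𝟎 , var 𝟏
      dₚ = var 𝟐 , var 𝟑

      -- The zero top row is a placeholder: the lower-left entry of g B g⁻¹ is the row (c , d) times
      -- B times the column (d , -c), which involves the bottom row alone.
      gₚ : M₂ₚ 4
      gₚ = matₚ 0ₚ 0ₚ cₚ dₚ

      c²+d²ₚ 2cdₚ 2c²ₚ : ℂₚ 4
      c²+d²ₚ = cₚ ⊗ cₚ ⊕ dₚ ⊗ dₚ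
      2cdₚ = cₚ ⊗ dₚ ⊕ cₚ ⊗ dₚ
      2c²ₚ = cₚ ⊗ cₚ ⊕ cₚ ⊗ cₚ

      -- The three values are the quadratic forms d² - c², -i(c² + d²) and 2cd.
      m₂₁ₚ : Fin 3 → ℂₚ 4
      m₂₁ₚ j = M₂ₚ.m₂₁ (gₚ ⊠ basisₚ j ⊠ adjₚ gₚ)

    c²+d²-gaussian : c *ℂ c +ℂ d *ℂ d ∈ IsGaussianInteger
    c²+d²-gaussian = ≈-gaussian
      (proveℂ ρ (iₚ ⊗ m₂₁ₚ 𝟏) c²+d²ₚ ≈-refl ≈-refl)
      (*-gaussian i-gaussian (m₂₁-gaussian 𝟏))

    2cd-gaussian : c *ℂ d +ℂ c *ℂ d ∈ IsGaussianInteger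
    2cd-gaussian = ≈-gaussian
      (proveℂ ρ (m₂₁ₚ 𝟐) 2cdₚ ≈-refl ≈-refl)
      (m₂₁-gaussian 𝟐)

    -- The difference of c² + d² and d² - c².
    2c²-gaussian : c *ℂ c +ℂ c *ℂ c ∈ IsGaussianInteger
    2c²-gaussian = ≈-gaussian
      (proveℂ ρ (iₚ ⊗ m₂₁ₚ 𝟏 ⊕ (⊖ m₂₁ₚ 𝟎)) 2c²ₚ ≈-refl ≈-refl)
      (+-gaussian (*-gaussian i-gaussian (m₂₁-gaussian 𝟏)) (neg-gaussian (m₂₁-gaussian 𝟎)))

    private
      e = (c +ℂ c) +ℂ d
      eₚ : ℂₚ 4
      eₚ = (cₚ ⊕ cₚ) ⊕ dₚ

    1≤∣c∣²+∣d∣² : 1# ≤ ∣ c ∣² + ∣ d ∣²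
    1≤∣c∣²+∣d∣² = 1≤row c d c²+d²-gaussian 2cd-gaussian (unimodular-row≉0 a b (proj₁ g∈Γ))

    -- (c , 2c + d) is the bottom row of g T₁².
    1≤∣c∣²+∣2c+d∣² : 1# ≤ ∣ c ∣² + ∣ e ∣²
    1≤∣c∣²+∣2c+d∣² = 1≤row c e
      (≈-gaussian
        (proveℂ ρ (c²+d²ₚ ⊕ ((2c²ₚ ⊕ 2c²ₚ) ⊕ (2cdₚ ⊕ 2cdₚ))) (cₚ ⊗ cₚ ⊕ eₚ ⊗ eₚ) ≈-refl ≈-refl)
        (+-gaussian c²+d²-gaussian
          (+-gaussian (+-gaussian 2c²-gaussian 2c²-gaussian) (+-gaussian 2cd-gaussian 2cd-gaussian))))
      (≈-gaussian
        (proveℂ ρ ((2c²ₚ ⊕ 2c²ₚ) ⊕ 2cdₚ) (cₚ ⊗ eₚ ⊕ cₚ ⊗ eₚ) ≈-refl ≈-refl)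
        (+-gaussian (+-gaussian 2c²-gaussian 2c²-gaussian) 2cd-gaussian))
      (unimodular-row≉0 a ((a +ℂ a) +ℂ b) (≈ℂ-trans
        (solve 8 (λ a₁ a₂ b₁ b₂ c₁ c₂ d₁ d₂ →
           proj₁ (A a₁ a₂ b₁ b₂ c₁ c₂ d₁ d₂) := proj₁ (B a₁ a₂ b₁ b₂ c₁ c₂ d₁ d₂))
           ≈-refl (re a) (im a) (re b) (im b) (re c) (im c) (re d) (im d) ,
         solve 8 (λ a₁ a₂ b₁ b₂ c₁ c₂ d₁ d₂ →
           proj₂ (A a₁ a₂ b₁ b₂ c₁ c₂ d₁ d₂) := proj₂ (B a₁ a₂ b₁ b₂ c₁ c₂ d₁ d₂))
           ≈-refl (re a) (im a) (re b) (im b) (re c) (im c) (re d) (im d))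
        (proj₁ g∈Γ)))
      where
      A B : (a₁ a₂ b₁ b₂ c₁ c₂ d₁ d₂ : Polynomial 8) → ℂₚ 8
      A a₁ a₂ b₁ b₂ c₁ c₂ d₁ d₂ =
        (a₁ , a₂) ⊗ (((c₁ , c₂) ⊕ (c₁ , c₂)) ⊕ (d₁ , d₂))
        ⊕ (⊖ ((((a₁ , a₂) ⊕ (a₁ , a₂)) ⊕ (b₁ , b₂)) ⊗ (c₁ , c₂)))
      B a₁ a₂ b₁ b₂ c₁ c₂ d₁ d₂ = (a₁ , a₂) ⊗ (d₁ , d₂) ⊕ (⊖ ((b₁ , b₂) ⊗ (c₁ , c₂)))

  -- The boundary is the semicircle with centre 1 and radius √2, the geodesic through i and 2 + i.
  AboveGeodesic : Carrier → Carrier → Set ℓ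
  AboveGeodesic x y = 2# ≤ (x - 1#) * (x - 1#) + y * y

  -- |cx + d|² + |c|²y² is |c|²((x-1)² + y² - 2) plus the affine function of x
  -- with values |c|² + |d|² at 0 and |c|² + |2c + d|² at 2.
  1≤den : ∀ {g x y} → g ∈ Γ → 𝒢ℝ x → AboveGeodesic x y → 1# ≤ den g x y
  1≤den {g} {x} {y} g∈Γ (0≤x , x≤2) above = 0≤y-x⇒x≤y (halve-nonNeg (≤-resp ≈-refl
    (solve 6 (λ c₁ c₂ d₁ d₂ x y →
       let 1′ = con (+ 1) ; 2′ = con (+ 2) ; c = c₁ , c₂ ; d = d₁ , d₂ in
       ((2′ :- x) :* ((∣ c ∣²ₚ :+ ∣ d ∣²ₚ) :- 1′)
        :+ x :* ((∣ c ∣²ₚ :+ ∣ (c ⊕ c) ⊕ d ∣²ₚ) :- 1′))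
       :+ (2′ :* ∣ c ∣²ₚ) :* (((x :- 1′) :* (x :- 1′) :+ y :* y) :- 2′)
       := 2′ :* ((∣ c ⊗ (x , con (+ 0)) ⊕ d ∣²ₚ :+ ∣ c ∣²ₚ :* (y :* y)) :- 1′))
      ≈-refl (re (m₂₁ g)) (im (m₂₁ g)) (re (m₂₂ g)) (im (m₂₂ g)) x y)
    (+-nonNeg (+-nonNeg
        (*-nonNeg (x≤y⇒0≤y-x x≤2) (x≤y⇒0≤y-x (1≤∣c∣²+∣d∣² g∈Γ)))
        (*-nonNeg 0≤x (x≤y⇒0≤y-x (1≤∣c∣²+∣2c+d∣² g∈Γ))))
      (*-nonNeg (*-nonNeg 0≤2 (∣∣²-nonNeg (m₂₁ g))) (x≤y⇒0≤y-x above)))))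

  private
    yn⁻¹ : ∀ {y e n} → e ≈ 1# → (y * e) * n ⁻¹ ≈ y * n ⁻¹
    yn⁻¹ {y} e≈1 = *-congʳ (≈-trans (*-congˡ e≈1) (*-identityʳ y))

  yℍ-maximal : ∀ {z} → q₁ z ≈ 0# → q₃ z ≈ 0# → 0# ≤ yℍ z → 𝒢ℝ (q₀ z) → AboveGeodesic (q₀ z) (yℍ z) →
               ∀ γ → γ ∈ Γ → yℍ (γ · z) ≤ yℍ z
  yℍ-maximal q₁≈0 q₃≈0 0≤y x∈ above γ γ∈Γ =
    ≤-resp (≈-sym (≈-trans (yℍ-· γ q₁≈0 q₃≈0) (yn⁻¹ (proj₁ (proj₁ γ∈Γ))))) ≈-refl
      (1≤n⇒yn⁻¹≤y 0≤y (1≤den γ∈Γ x∈ above))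

  im-maximal : ∀ {z} → 0# ≤ im z → 𝒢ℝ (re z) → AboveGeodesic (re z) (im z) →
               ∀ γ → γ ∈ Γℝ → im (γ ·₂ z) ≤ im z
  im-maximal {z} 0≤y x∈ above γ (γ∈Γ , _ , γ∈ℝ) =
    ≤-resp (≈-sym (≈-trans (im-·₂ γ z γ∈ℝ) (yn⁻¹ (proj₁ (proj₁ γ∈Γ))))) ≈-refl
      (1≤n⇒yn⁻¹≤y 0≤y (1≤den γ∈Γ x∈ above))

  -- The rotation `R` in `Γℝ` and the condition it forces.

  h : Carrier
  h = √2 ⁻¹

  -- This is the relation fed to `Modulo`: det R, the entries of R Bⱼ R⁻¹ and ω₈² are quadratic in
  -- h, so homogenising the constants they equal by 2h² leaves polynomial identities.
  2h²≈1 : h * h + h * h ≈ 1#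
  2h²≈1 = begin
    h * h + h * h        ≈⟨ solve 1 (λ h → h :* h :+ h :* h := con (+ 2) :* (h :* h)) ≈-refl h ⟩
    2# * (h * h)         ≈⟨ *-congʳ √2*√2≈2 ⟨
    √2 * √2 * (h * h)    ≈⟨ solve 2 (λ s h → s :* s :* (h :* h) := (s :* h) :* (s :* h)) ≈-refl √2 h ⟩
    (√2 * h) * (√2 * h)  ≈⟨ *-cong √2h≈1 √2h≈1 ⟩
    1# * 1#              ≈⟨ *-identityˡ 1# ⟩
    1#                   ∎
    where
    open SetoidReasoning setoid
    √2≉0 : ¬ √2 ≈ 0#
    √2≉0 e = 0≉1 (antisym 0≤1 (≤-trans (RealFacts.1≤√2 ℛ) (≤-reflexive e)))
    √2h≈1 = ⁻¹-inverseʳ √2≉0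

  open Modulo (h ∷ []) (var 𝟎 :* var 𝟎 :+ var 𝟎 :* var 𝟎) 2h²≈1 public

  -- The rotation by π/2 about i, whose isometric circle is |z - 1| = √2.
  R : M₂
  R = mat (fromℝ h) (fromℝ h) (fromℝ (- h)) (fromℝ h)

  -- R is the exponential of -(π/4) i X₂, so conjugation by it fixes X₂; the other columns record
  -- that X₁ goes to Y and Y to -X₁.
  𝐜R : M₃
  𝐜R 𝟎 𝟐 = -ℂ 1ℂ
  𝐜R 𝟏 𝟏 = 1ℂ
  𝐜R 𝟐 𝟎 = 1ℂ
  𝐜R _ _ = 0ℂ

  private
    Rₚ : M₂ₚ 1
    Rₚ = matₚ (var 𝟎 , con (+ 0)) (var 𝟎 , con (+ 0)) (:- var 𝟎 , con (+ 0)) (var 𝟎 , con (+ 0))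

    𝐜Rₚ : ∀ {n} → Fin 3 → Fin 3 → ℂₚ n
    𝐜Rₚ 𝟎 𝟐 = ⊖ 1ₚ
    𝐜Rₚ 𝟏 𝟏 = 1ₚ
    𝐜Rₚ 𝟐 𝟎 = 1ₚ
    𝐜Rₚ _ _ = 0ₚ

    lhsₚ rhsₚ : Fin 3 → M₂ₚ 1
    lhsₚ j = Rₚ ⊠ basisₚ j ⊠ adjₚ Rₚ
    rhsₚ j = 𝐜Rₚ 𝟎 j ⊡ basisₚ 𝟎 ⊞ 𝐜Rₚ 𝟏 j ⊡ basisₚ 𝟏 ⊞ 𝐜Rₚ 𝟐 j ⊡ basisₚ 𝟐

  R-is-𝐜R : 𝐜R Is𝐜 R
  R-is-𝐜R 𝟎 = proveM-mod (lhsₚ 𝟎) (rhsₚ 𝟎) ((≈-refl , ≈-refl) , (≈-refl , ≈-refl) , (≈-refl , ≈-refl) , (≈-refl , ≈-refl))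
  R-is-𝐜R 𝟏 = proveM-mod (lhsₚ 𝟏) (rhsₚ 𝟏) ((≈-refl , ≈-refl) , (≈-refl , ≈-refl) , (≈-refl , ≈-refl) , (≈-refl , ≈-refl))
  R-is-𝐜R 𝟐 = proveM-mod (lhsₚ 𝟐) (rhsₚ 𝟐) ((≈-refl , ≈-refl) , (≈-refl , ≈-refl) , (≈-refl , ≈-refl) , (≈-refl , ≈-refl))

  det-R : det R ≈ℂ 1ℂ
  det-R = proveℂ-mod ((v , z) ⊗ (v , z) ⊕ (⊖ ((v , z) ⊗ (:- v , z)))) 1ₚ (≈-refl , ≈-refl)
    where v = var 𝟎
          z = con (+ 0)

  𝐜R∈SO₃ℤ[i] : 𝐜R ∈ SO₃ℤ[i]
  𝐜R∈SO₃ℤ[i] = (orthogonal , proveℂ []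
      (A 𝟎 𝟎 ⊗ (A 𝟏 𝟏 ⊗ A 𝟐 𝟐 ⊕ (⊖ (A 𝟏 𝟐 ⊗ A 𝟐 𝟏)))
       ⊕ (⊖ (A 𝟎 𝟏 ⊗ (A 𝟏 𝟎 ⊗ A 𝟐 𝟐 ⊕ (⊖ (A 𝟏 𝟐 ⊗ A 𝟐 𝟎)))))
       ⊕ A 𝟎 𝟐 ⊗ (A 𝟏 𝟎 ⊗ A 𝟐 𝟏 ⊕ (⊖ (A 𝟏 𝟏 ⊗ A 𝟐 𝟎)))) 1ₚ ≈-refl ≈-refl) , integral
    where
    A : Fin 3 → Fin 3 → ℂₚ 0
    A = 𝐜Rₚ

    gram : Fin 3 → Fin 3 → ℂₚ 0
    gram j k = A 𝟎 j ⊗ A 𝟎 k ⊕ A 𝟏 j ⊗ A 𝟏 k ⊕ A 𝟐 j ⊗ A 𝟐 k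

    orthogonal : ∀ j k → 𝐜R 𝟎 j *ℂ 𝐜R 𝟎 k +ℂ 𝐜R 𝟏 j *ℂ 𝐜R 𝟏 k +ℂ 𝐜R 𝟐 j *ℂ 𝐜R 𝟐 k ≈ℂ I₃ j k
    orthogonal 𝟎 𝟎 = proveℂ [] (gram 𝟎 𝟎) 1ₚ ≈-refl ≈-refl
    orthogonal 𝟎 𝟏 = proveℂ [] (gram 𝟎 𝟏) 0ₚ ≈-refl ≈-refl
    orthogonal 𝟎 𝟐 = proveℂ [] (gram 𝟎 𝟐) 0ₚ ≈-refl ≈-refl
    orthogonal 𝟏 𝟎 = proveℂ [] (gram 𝟏 𝟎) 0ₚ ≈-refl ≈-refl
    orthogonal 𝟏 𝟏 = proveℂ [] (gram 𝟏 𝟏) 1ₚ ≈-refl ≈-refl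
    orthogonal 𝟏 𝟐 = proveℂ [] (gram 𝟏 𝟐) 0ₚ ≈-refl ≈-refl
    orthogonal 𝟐 𝟎 = proveℂ [] (gram 𝟐 𝟎) 0ₚ ≈-refl ≈-refl
    orthogonal 𝟐 𝟏 = proveℂ [] (gram 𝟐 𝟏) 0ₚ ≈-refl ≈-refl
    orthogonal 𝟐 𝟐 = proveℂ [] (gram 𝟐 𝟐) 1ₚ ≈-refl ≈-refl

    integral : ∀ j k → IsGaussianInteger (𝐜R j k)
    integral 𝟎 𝟎 = 0-gaussian
    integral 𝟎 𝟏 = 0-gaussian
    integral 𝟎 𝟐 = neg-gaussian 1-gaussian
    integral 𝟏 𝟎 = 0-gaussian
    integral 𝟏 𝟏 = 1-gaussian
    integral 𝟏 𝟐 = 0-gaussian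
    integral 𝟐 𝟎 = 1-gaussian
    integral 𝟐 𝟏 = 0-gaussian
    integral 𝟐 𝟐 = 0-gaussian

  R∈Γℝ : R ∈ Γℝ
  R∈Γℝ = (det-R , 𝐜R , R-is-𝐜R , 𝐜R∈SO₃ℤ[i]) , det-R , ≈-refl , ≈-refl , ≈-refl , ≈-refl

  -- The bottom row of R is (-h , h) with 2h² = 1, so twice `den R x y` is (x - 1)² + y², and the
  -- height comparison for R says that `den R x y` is at least 1.
  above-geodesic : ∀ {x y} → 0# < y → y * den R x y ⁻¹ ≤ y → AboveGeodesic x y
  above-geodesic {x} {y} 0<y@(0≤y , 0≉y) p = 0≤y-x⇒x≤y (≤-resp ≈-refl
      (≈-trans (solve 1 (λ n → con (+ 2) :* (n :- con (+ 1)) := con (+ 2) :* n :- con (+ 2)) ≈-refl (den R x y))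
        (+-congʳ 2den))
      (*-nonNeg 0≤2 (x≤y⇒0≤y-x (yn⁻¹≤y⇒1≤n 0<y (0≤den , 0≉den) p))))
    where
    2den : 2# * den R x y ≈ (x - 1#) * (x - 1#) + y * y
    2den = ≈-trans
      (solve 3 (λ h x y →
         let 0′ = con (+ 0) ; c = :- h , 0′ ; d = h , 0′ ; x-1 = x :- con (+ 1) in
         con (+ 2) :* (∣ c ⊗ (x , 0′) ⊕ d ∣²ₚ :+ ∣ c ∣²ₚ :* (y :* y))
         := (h :* h :+ h :* h) :* (x-1 :* x-1 :+ y :* y)) ≈-refl h x y)
      (≈-trans (*-congʳ 2h²≈1) (*-identityˡ _))
    0≤den : 0# ≤ den R x y
    0≤den = halve-nonNeg (≤-resp ≈-refl (≈-sym 2den) (+-nonNeg (sq-nonNeg _) (sq-nonNeg _)))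
    -- A vanishing denominator would force (x - 1)² + y² = 0 and hence y = 0.
    0≉den : ¬ 0# ≈ den R x y
    0≉den e = 0≉y (≈-sym (sq≈0⇒≈0 (+≈0⇒≈0ˡ (sq-nonNeg y) (sq-nonNeg (x - 1#))
      (≈-trans (+-comm _ _) (≈-trans (≈-sym 2den) (≈-trans (*-congˡ (≈-sym e)) (zeroʳ 2#)))))))

  yℍ-R : ∀ {z} → q₁ z ≈ 0# → q₃ z ≈ 0# → yℍ (R · z) ≈ yℍ z * den R (q₀ z) (yℍ z) ⁻¹
  yℍ-R q₁≈0 q₃≈0 = ≈-trans (yℍ-· R q₁≈0 q₃≈0) (yn⁻¹ (proj₁ det-R))

  im-R : ∀ z → im (R ·₂ z) ≈ im z * den R (re z) (im z) ⁻¹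
  im-R z = ≈-trans (im-·₂ R z (≈-refl , ≈-refl , ≈-refl , ≈-refl)) (yn⁻¹ (proj₁ det-R))

-- Comparison of the two domains through a common region.

module FundamentalDomains {r ℓ} (ℛ : Reals r ℓ) where
  open Reals ℛ
  open RealFacts ℛ using (2#)
  open Geometry ℛ
  open IntegerSolver ℛ hiding (⟦_⟧)
  open OrderedField ℛ
  open ComplexAlgebra ℛ
  open Heights ℛ

  -- The value of T₁ R²_{π/2} T₁⁻¹, the rotation by π about the vertical geodesic over 1.
  halfTurn : M₂
  halfTurn = mat iℂ (-ℂ (iℂ +ℂ iℂ)) 0ℂ (-ℂ iℂ)

  private
    T₁ₚ R²ₚ halfTurnₚ : ∀ {n} → M₂ₚ n
    T₁ₚ = matₚ 1ₚ 1ₚ 0ₚ 1ₚ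
    R²ₚ = matₚ iₚ 0ₚ 0ₚ (⊖ iₚ)
    halfTurnₚ = matₚ iₚ (⊖ (iₚ ⊕ iₚ)) 0ₚ (⊖ iₚ)

    ωₚ : M₂ₚ 1
    ωₚ = matₚ (var 𝟎 , var 𝟎) 0ₚ 0ₚ (var 𝟎 , :- var 𝟎)

  T₁Rπ/2²T₁⁻¹≈halfTurn : T₁ *M (Rπ/2 *M Rπ/2) *M T₁ ⁻¹M ≈M halfTurn
  T₁Rπ/2²T₁⁻¹≈halfTurn = ≈M-trans
    (*M-cong (*M-cong (≈M-refl {T₁}) (≈M-trans (*M-cong Rπ/2≈ Rπ/2≈)
      -- ω₈² = 2h² i, which the relation 2h² = 1 turns into i.
      (proveM-mod (ωₚ ⊠ ωₚ) R²ₚ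
      ((≈-refl , ≈-refl) , (≈-refl , ≈-refl) , (≈-refl , ≈-refl) , (≈-refl , ≈-refl))))) (≈M-refl {T₁ ⁻¹M}))
    -- Only Gaussian integer constants remain, so the modulus is the trivial relation 1 = 1.
    (Modulo.proveM-mod [] (con (+ 1)) ≈-refl (T₁ₚ ⊠ R²ₚ ⊠ adjₚ T₁ₚ) halfTurnₚ
      ((≈-refl , ≈-refl) , (≈-refl , ≈-refl) , (≈-refl , ≈-refl) , (≈-refl , ≈-refl)))
    where
    -- |ω₈|² = 2h² = 1, so the inverse is the complex conjugate.
    ω̄≈ : ω₈ ⁻¹ℂ ≈ℂ (h +i (- h))
    ω̄≈ = ≈-trans (*-congˡ (1⁻¹≈1 2h²≈1)) (*-identityʳ _) , ≈-trans (*-congˡ (1⁻¹≈1 2h²≈1)) (*-identityʳ _)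
    Rπ/2≈ : Rπ/2 ≈M mat ω₈ 0ℂ 0ℂ (h +i (- h))
    Rπ/2≈ = ≈ℂ-refl , ≈ℂ-refl , ≈ℂ-refl , ω̄≈

  -- The denominator cz + d is the constant -i; its norm is 1, which is why `reduce` can drop the
  -- factor `n ⁻¹`.
  halfTurn-· : ∀ z → halfTurn · z ≈ℍ quat (2# - q₀ z) (- q₁ z) (q₂ z) (q₃ z)
  halfTurn-· z@(quat a b c d) =
      reduce (solve 5 (λ a b c d u → proj₁ (image a b c d u) := (con (+ 2) :- a) :* u) ≈-refl a b c d (n ⁻¹))
    , reduce (solve 5 (λ a b c d u → proj₁ (proj₂ (image a b c d u)) := (:- b) :* u) ≈-refl a b c d (n ⁻¹))
    , reduce (solve 5 (λ a b c d u → jₚ (image a b c d u) := c :* u) ≈-refl a b c d (n ⁻¹))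
    , reduce (solve 5 (λ a b c d u → proj₂ (proj₂ (proj₂ (image a b c d u))) := d :* u) ≈-refl a b c d (n ⁻¹))
    where
    image : ∀ {n} → (a b c d u : Polynomial n) → ℍₚ n
    image a b c d u = affineₚ iₚ (⊖ (iₚ ⊕ iₚ)) (a , b , c , d) ⊗ℍ invₚ (affineₚ 0ₚ (⊖ iₚ) (a , b , c , d)) u
    v = fromℂ 0ℂ *ℍ z +ℍ fromℂ (-ℂ iℂ)
    n = q₀ v * q₀ v + q₁ v * q₁ v + q₂ v * q₂ v + q₃ v * q₃ v
    n≈1 : n ≈ 1#
    n≈1 = solve 4 (λ a b c d → normₚ (affineₚ 0ₚ (⊖ iₚ) (a , b , c , d)) := con (+ 1)) ≈-refl a b c d
    reduce : ∀ {x y} → x ≈ y * n ⁻¹ → x ≈ y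
    reduce p = ≈-trans p (≈-trans (*-congˡ (1⁻¹≈1 n≈1)) (*-identityʳ _))

  -- In barycentric coordinates x = r + 2s + t, so x - 1 = s and 2 - x = r + t.
  𝒢⇒1≤x≤2 : ∀ {z} → z ∈ 𝒢 → 1# ≤ re z × re z ≤ 2#
  𝒢⇒1≤x≤2 {z} (r , s , t , 0≤r , 0≤s , 0≤t , r+s+t≈1 , re≈ , _) =
      0≤y-x⇒x≤y (≤-resp ≈-refl (≈-trans
        (solve 3 (λ r s t → s := x r s t :- (r :+ s :+ t)) ≈-refl r s t)
        (+-cong (≈-sym re≈) (-‿cong r+s+t≈1))) 0≤s)
    , 0≤y-x⇒x≤y (≤-resp ≈-refl (≈-trans
        (solve 3 (λ r s t → r :+ t := con (+ 2) :* (r :+ s :+ t) :- x r s t) ≈-refl r s t)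
        (+-cong (≈-trans (*-congˡ r+s+t≈1) (*-identityʳ 2#)) (-‿cong (≈-sym re≈)))) (+-nonNeg 0≤r 0≤t))
    where
    x : ∀ {n} → (r s t : Polynomial n) → Polynomial n
    x r s t = proj₁ ((r , con (+ 0)) ⊗ 1ₚ ⊕ (s , con (+ 0)) ⊗ (con (+ 2) , con (+ 0)) ⊕ (t , con (+ 0)) ⊗ (1ₚ ⊕ iₚ))

  -- The point lies on the edge from 1 to 2, with weights 2 - x and x - 1 there and 0 at 1 + i.
  1≤x≤2⇒𝒢 : ∀ {z} → IsReal z → 1# ≤ re z → re z ≤ 2# → z ∈ 𝒢
  1≤x≤2⇒𝒢 {x +i y} y≈0 1≤x x≤2 = 2# - x , x - 1# , 0# ,
    x≤y⇒0≤y-x x≤2 , x≤y⇒0≤y-x 1≤x , ≤-refl ,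
    solve 1 (λ x → (con (+ 2) :- x) :+ (x :- con (+ 1)) :+ con (+ 0) := con (+ 1)) ≈-refl x ,
    solve 1 (λ x → x := proj₁ (combination x)) ≈-refl x ,
    ≈-trans y≈0 (solve 1 (λ x → con (+ 0) := proj₂ (combination x)) ≈-refl x)
    where
    combination : ∀ {n} → Polynomial n → ℂₚ n
    combination x = (con (+ 2) :- x , con (+ 0)) ⊗ 1ₚ ⊕ (x :- con (+ 1) , con (+ 0)) ⊗ (con (+ 2) , con (+ 0))
                    ⊕ (con (+ 0) , con (+ 0)) ⊗ (1ₚ ⊕ iₚ)

  -- The explicit set to which both sides of the theorem are shown equal.
  record Region (w : ℍ) : Set ℓ where
    constructor region
    field
      q₁≈0  : q₁ w ≈ 0#
      q₃≈0  : q₃ w ≈ 0#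
      0<y   : 0# < yℍ w
      x∈𝒢ℝ  : 𝒢ℝ (q₀ w)
      above : AboveGeodesic (q₀ w) (yℍ w)

  Region-resp : ∀ {v w} → v ≈ℍ w → Region v → Region w
  Region-resp (e₀ , e₁ , e₂ , e₃) (region q₁≈0 q₃≈0 (0≤y , 0≉y) (0≤x , x≤2) above) = region
    (≈-trans (≈-sym e₁) q₁≈0) (≈-trans (≈-sym e₃) q₃≈0)
    (≤-resp ≈-refl e₂ 0≤y , λ p → 0≉y (≈-trans p (≈-sym e₂)))
    (≤-resp ≈-refl e₀ 0≤x , ≤-resp e₀ ≈-refl x≤2)
    (≤-resp ≈-refl (+-cong (*-cong (+-congʳ e₀) (+-congʳ e₀)) (*-cong e₂ e₂)) above)

  reflect : ℍ → ℍ
  reflect (quat a b c d) = quat (2# - a) (- b) c d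

  reflect-involutive : ∀ w → reflect (reflect w) ≈ℍ w
  reflect-involutive (quat a b c d) =
      solve 1 (λ a → con (+ 2) :- (con (+ 2) :- a) := a) ≈-refl a
    , solve 1 (λ b → :- (:- b) := b) ≈-refl b , ≈-refl , ≈-refl

  -- Replacing x by 2 - x preserves (x - 1)² and exchanges the bounds 0 ≤ x and x ≤ 2.
  Region-reflect : ∀ {w} → Region w → Region (reflect w)
  Region-reflect {quat a b c d} (region q₁≈0 q₃≈0 0<y (0≤x , x≤2) above) = region
    (≈-trans (-‿cong q₁≈0) (prove [] (:- con (+ 0)) (con (+ 0)) ≈-refl)) q₃≈0 0<y
    ( x≤y⇒0≤y-x x≤2
    , 0≤y-x⇒x≤y (≤-resp ≈-refl (solve 1 (λ a → a := con (+ 2) :- (con (+ 2) :- a)) ≈-refl a) 0≤x))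
    (≤-resp ≈-refl (solve 2 (λ a c →
      let x = a :- con (+ 1) ; x′ = (con (+ 2) :- a) :- con (+ 1)
      in x :* x :+ c :* c := x′ :* x′ :+ c :* c) ≈-refl a c) above)

  -- Maximality of the height is tested on the single element `R`.
  ℱℝ⇒Region : ∀ {z} → z ∈ ℱℝ 𝒢ℝ → Region (toℍ²ⱼ z)
  ℱℝ⇒Region {z} (0<y , x∈ , maximal) = region ≈-refl ≈-refl 0<y x∈
    (above-geodesic 0<y (≤-resp (im-R z) ≈-refl (maximal R R∈Γℝ)))

  Region⇒ℱℝ : ∀ {w} → Region w → w ∈ toℍ²ⱼ⟦ ℱℝ 𝒢ℝ ⟧
  Region⇒ℱℝ {w} (region q₁≈0 q₃≈0 0<y x∈ above) = q₀ w +i q₂ w ,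
    (0<y , x∈ , im-maximal (proj₁ 0<y) x∈ above) , ≈-refl , q₁≈0 , ≈-refl , q₃≈0

  ℱ⇒Region : ∀ {w} → w ∈ ℱ 𝒢 → q₁ w ≈ 0# → Region w
  ℱ⇒Region {w} ((q₃≈0 , 0<y) , x∈ , maximal) q₁≈0 = let 1≤x , x≤2 = 𝒢⇒1≤x≤2 x∈ in
    region q₁≈0 q₃≈0 0<y (≤-trans 0≤1 1≤x , x≤2)
      (above-geodesic 0<y (≤-resp (yℍ-R {w} q₁≈0 q₃≈0) ≈-refl (maximal R (proj₁ R∈Γℝ))))

  Region⇒ℱ : ∀ {w} → Region w → 1# ≤ q₀ w → w ∈ ℱ 𝒢
  Region⇒ℱ (region q₁≈0 q₃≈0 0<y x∈ above) 1≤x = (q₃≈0 , 0<y) ,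
    1≤x≤2⇒𝒢 q₁≈0 1≤x (proj₂ x∈) , yℍ-maximal q₁≈0 q₃≈0 (proj₁ 0<y) x∈ above

  module _ {g} (g≈halfTurn : g ≈M halfTurn) where

    -- The action respects `_≈M_`, so every matrix equal to `halfTurn` acts as `reflect`.
    g-· : ∀ z → g · z ≈ℍ reflect z
    g-· z = ≈ℍ-trans {g · z} (·-cong {g} {halfTurn} {z} {z} g≈halfTurn ≈ℍ-refl) (halfTurn-· z)

    -- The line x = 1 cuts the region in two. The right half lies in `ℱ 𝒢`; a point of the left half
    -- is reflected into the right half, and g carries it back because `reflect` is an involution.
    Region⇒ℱ∪gℱ : ∀ {w} → Region w → w ∈ ℱ 𝒢 ∪ g ⟦ ℱ 𝒢 ⟧
    Region⇒ℱ∪gℱ {w} W with total 1# (q₀ w)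
    ... | inj₁ 1≤x = inj₁ (Region⇒ℱ W 1≤x)
    ... | inj₂ x≤1 = inj₂ (reflect w , Region⇒ℱ (Region-reflect W) 1≤2-x ,
      ≈ℍ-sym {g · reflect w} (≈ℍ-trans {g · reflect w} (g-· (reflect w)) (reflect-involutive w)))
      where
      1≤2-x : 1# ≤ 2# - q₀ w
      1≤2-x = 0≤y-x⇒x≤y (≤-resp ≈-refl
        (solve 1 (λ x → con (+ 1) :- x := (con (+ 2) :- x) :- con (+ 1)) ≈-refl (q₀ w)) (x≤y⇒0≤y-x x≤1))

    gℱ⇒Region : ∀ {w} → w ∈ g ⟦ ℱ 𝒢 ⟧ → q₁ w ≈ 0# → Region w
    gℱ⇒Region {w} (z , z∈ , w≈) q₁w≈0 =
      Region-resp (≈ℍ-sym w≈reflect) (Region-reflect (ℱ⇒Region z∈ q₁z≈0))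
      where
      w≈reflect : w ≈ℍ reflect z
      w≈reflect = ≈ℍ-trans {w} {g · z} w≈ (g-· z)
      -- `reflect` negates q₁, so w lies over the real line exactly when z does.
      q₁z≈0 : q₁ z ≈ 0#
      q₁z≈0 = ≈-trans (solve 1 (λ b → b := :- (:- b)) ≈-refl (q₁ z))
        (≈-trans (-‿cong (≈-trans (≈-sym (proj₁ (proj₂ w≈reflect))) q₁w≈0))
          (prove [] (:- con (+ 0)) (con (+ 0)) ≈-refl))

    ℱℝ≐ℱ∪gℱ : toℍ²ⱼ⟦ ℱℝ 𝒢ℝ ⟧ ≐ (ℱ 𝒢 ∪ g ⟦ ℱ 𝒢 ⟧) ∩ ℍ²ⱼ
    ℱℝ≐ℱ∪gℱ =
        (λ { (z , z∈ , w≈) → let W = Region-resp (≈ℍ-sym w≈) (ℱℝ⇒Region z∈)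
                             in Region⇒ℱ∪gℱ W , (Region.q₃≈0 W , Region.0<y W) , Region.q₁≈0 W })
      , (λ { (inj₁ w∈ , _ , q₁≈0) → Region⇒ℱℝ (ℱ⇒Region w∈ q₁≈0)
           ; (inj₂ w∈ , _ , q₁≈0) → Region⇒ℱℝ (gℱ⇒Region w∈ q₁≈0) })

proposition1p3p2p10 : ∀ {c ℓ} (ℛ : Reals c ℓ) → let open Geometry ℛ in
    toℍ²ⱼ⟦ ℱℝ 𝒢ℝ ⟧ ≐ (ℱ 𝒢 ∪ (T₁ *M (Rπ/2 *M Rπ/2) *M T₁ ⁻¹M) ⟦ ℱ 𝒢 ⟧) ∩ ℍ²ⱼ
proposition1p3p2p10 ℛ = ℱℝ≐ℱ∪gℱ T₁Rπ/2²T₁⁻¹≈halfTurn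
  where open FundamentalDomains ℛ
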